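{- For every integer $n\geq 8$, $$f_{\mathcal{OP}}(n,P_4)=2n^2-7n+2.$$ Moreover, for every $n\geq 9$, the only $n$-vertex outerplanar graph (up to isomorphism) containing exactly $f_{\mathcal{OP}}(n,P_4)$ copies of $P_4$ is $K_1+P_{n-1}$, the graph obtained from a path on $n-1$ vertices by adding one new vertex adjacent to all $n-1$ path vertices.
   Context: $P_k$ denotes the path on $k$ vertices. For graphs $H$ and $G$, $\mathcal{N}(H,G)$ denotes the number of subgraphs of $G$ isomorphic to $H$. The generalized outerplanar Turán number of $H$ is $f_{\mathcal{OP}}(n,H)=\max\{\mathcal{N}(H,G): G \text{ is an } n\text{ -vertex outerplanar graph}\}$. $K_1+P_{n-1}$ denotes the join of a single vertex with $P_{n-1}$. -}

module Defs where

open import Data.Bool using (Bool; true; false; _∧_; _∨_; not; T)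
open import Data.Bool.Properties using (∨-comm)
open import Data.Nat using (ℕ; zero; suc; _/_; _<_)
import Data.Nat as ℕ
open import Data.Nat.Properties using (<-irrefl; n<1+n)
open import Data.Fin using (Fin; toℕ) renaming (zero to fz; suc to fs)
import Data.Fin as Fin
open import Data.Fin.Permutation using (Permutation′; _⟨$⟩ʳ_)
open import Data.List using (List; []; _∷_; [_]; map; concatMap; foldr; length; filter; allFin)
open import Data.Vec using (Vec; lookup) renaming ([] to []ᵥ; _∷_ to _∷ᵥ_)
open import Data.Product using (Σ; ∃; _×_)
open import Relation.Nullary using (¬_; does)
open import Relation.Nullary.Decidable using (dec-false)
open import Relation.Binary.PropositionalEquality using (_≡_; refl; sym)

record Graph (n : ℕ) : Set where
  field
    adj    : Fin n → Fin n → Bool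
    adj-sym   : ∀ x y → adj x y ≡ adj y x
    adj-irrefl : ∀ x → adj x x ≡ false
open Graph public

Edge : ∀ {n} → Graph n → Fin n → Fin n → Set
Edge G x y = T (adj G x y)

_≅_ : ∀ {n} → Graph n → Graph n → Set
_≅_ {n} G F = Σ (Permutation′ n) λ π →
  ∀ x y → adj G x y ≡ adj F (π ⟨$⟩ʳ x) (π ⟨$⟩ʳ y)

-- Outerplanarity: G is outerplanar iff its vertices can be placed on a
-- circle (cyclic order given by a permutation pos) so that, with edges
-- drawn as chords, no two edges cross.  Edges uv and xy cross iff
-- pos u < pos x < pos v < pos y (all orientations are covered since we
-- quantify over all u v x y).

Outerplanar : ∀ {n} → Graph n → Set
Outerplanar {n} G = Σ (Permutation′ n) λ pos →
  ∀ u v x y → Edge G u v → Edge G x y →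
    ¬ ((pos ⟨$⟩ʳ u) Fin.< (pos ⟨$⟩ʳ x) ×
       (pos ⟨$⟩ʳ x) Fin.< (pos ⟨$⟩ʳ v) ×
       (pos ⟨$⟩ʳ v) Fin.< (pos ⟨$⟩ʳ y))

-- Counting copies of H in G:
--   N(H,G) = #(injective homomorphisms H → G) / #(automorphisms of H)
-- (the number of subgraphs of G isomorphic to H).

allVecs : (k n : ℕ) → List (Vec (Fin n) k)
allVecs zero    n = [ []ᵥ ]
allVecs (suc k) n = concatMap (λ v → map (_∷ᵥ v) (allFin n)) (allVecs k n)

allB : ∀ {A : Set} → (A → Bool) → List A → Bool
allB p = foldr (λ a b → p a ∧ b) true

isEmbedding : ∀ {k n} → Graph k → Graph n → (Fin k → Fin n) → Bool
isEmbedding {k} H G f =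
  allB (λ i → allB (λ j →
        (does (i Fin.≟ j) ∨ not (does (f i Fin.≟ f j))) ∧
        (not (adj H i j) ∨ adj G (f i) (f j)))
      (allFin k)) (allFin k)

countEmb : ∀ {k n} → Graph k → Graph n → ℕ
countEmb {k} {n} H G =
  length (filter (λ v → isEmbedding H G (lookup v) Data.Bool.≟ true) (allVecs k n))
  where import Data.Bool

-- division with d = 0 mapped to 0 (never used: aut(H) ≥ 1)
divℕ : ℕ → ℕ → ℕ
divℕ m zero    = zero
divℕ m (suc d) = m / suc d

copies : ∀ {k n} → Graph k → Graph n → ℕ
copies H G = divℕ (countEmb H G) (countEmb H H)

nbrℕ : ℕ → ℕ → Bool
nbrℕ a b = does (suc a ℕ.≟ b) ∨ does (suc b ℕ.≟ a)

nbrℕ-sym : ∀ a b → nbrℕ a b ≡ nbrℕ b a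
nbrℕ-sym a b = ∨-comm (does (suc a ℕ.≟ b)) (does (suc b ℕ.≟ a))

nbrℕ-irrefl : ∀ a → nbrℕ a a ≡ false
nbrℕ-irrefl a rewrite dec-false (suc a ℕ.≟ a) (λ e → <-irrefl (sym e) (n<1+n a)) = refl

Path : (k : ℕ) → Graph k
Path k = record
  { adj = λ i j → nbrℕ (toℕ i) (toℕ j)
  ; adj-sym = λ i j → nbrℕ-sym (toℕ i) (toℕ j)
  ; adj-irrefl = λ i → nbrℕ-irrefl (toℕ i)
  }

fanAdj : ∀ {n} → Fin n → Fin n → Bool
fanAdj fz     fz     = false
fanAdj fz     (fs _) = true
fanAdj (fs _) fz     = true
fanAdj (fs i) (fs j) = nbrℕ (toℕ i) (toℕ j)

fanAdj-sym : ∀ {n} (x y : Fin n) → fanAdj x y ≡ fanAdj y x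
fanAdj-sym fz     fz     = refl
fanAdj-sym fz     (fs _) = refl
fanAdj-sym (fs _) fz     = refl
fanAdj-sym (fs i) (fs j) = nbrℕ-sym (toℕ i) (toℕ j)

fanAdj-irrefl : ∀ {n} (x : Fin n) → fanAdj x x ≡ false
fanAdj-irrefl fz     = refl
fanAdj-irrefl (fs i) = nbrℕ-irrefl (toℕ i)

Fan : (n : ℕ) → Graph n
Fan n = record { adj = fanAdj ; adj-sym = fanAdj-sym ; adj-irrefl = fanAdj-irrefl }

{-# OPTIONS --safe #-}
-- Every non-crossing graph on a circle has, up to a dihedral relabelling, one of two local shapes,
-- found under a shortest chord of length at least 3: an ear 1 on the edge 02 with N(2) ⊆ {0,1,3}, or
-- ears 1 and 3 on the edges 02 and 24 with N(2) ⊆ {0,1,3,4}.  Two vertices have at most two common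
-- neighbours (at most one if they are consecutive on the circle), which bounds the copies of P₄
-- through an ear: in the first shape deleting 1 destroys at most 4n − 10 copies unless 0 is adjacent
-- to all of 3, …, n − 1, and then the graph lies in the fan with hub 0; in the second shape deleting
-- 1 and 3 destroys at most 7n − 15 copies.  Starting from the triangle these losses give the bounds
-- 6, 17, 33, 51 for n = 4, …, 7 and then 2n² − 7n + 2, strictly less for n ≥ 9 unless the graph lies
-- in a fan; and every edge of the fan lies in a copy of P₄.
module Submission where

open import Defs
import Algebra.Properties.CommutativeMonoid.Sum as CommutativeMonoidSum
open import Data.Bool using (Bool; true; false; _∧_; _∨_; not)
import Data.Bool
open import Data.Bool.Properties using (∧-conicalˡ; ∧-conicalʳ; ¬-not; T-≡)
open import Data.Empty using (⊥; ⊥-elim)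
open import Data.Fin using (Fin; toℕ; punchIn; punchOut; _≟_; fromℕ; fromℕ<; opposite) renaming (zero to fz; suc to fs)
import Data.Fin as Fin
open import Data.Fin.Patterns using (0F; 1F; 2F; 3F; 4F)
open import Data.Fin.Permutation using (Permutation; Permutation′; _⟨$⟩ʳ_; _⟨$⟩ˡ_; inverseˡ; inverseʳ; _∘ₚ_; insert; reverse; flip) renaming (id to idₚ)
open import Data.Fin.Properties using (punchInᵢ≢i; punchIn-injective; punchIn-punchOut; punchIn-cancel-≤; toℕ-fromℕ<; toℕ-injective; toℕ<n; toℕ≤pred[n]; opposite-prop; ≤fromℕ; any?)
import Data.Fin.Properties as Finₚ
open import Data.List using (List; []; _∷_; _++_; map; concatMap; filter; length; allFin; tabulate)
open import Data.List.Membership.Propositional using (_∈_)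
open import Data.List.Membership.Propositional.Properties using (∈-allFin)
open import Data.List.Relation.Unary.Any using (here; there)
open import Data.Nat using (ℕ; zero; suc; _+_; _*_; _∸_; _/_; _≤_; _<_; _≤?_; _<?_; _≡ᵇ_; z≤n; s≤s)
import Data.Nat as ℕ
open import Data.Nat.DivMod using (m*n/n≡m; m/n*n≤m; /-monoˡ-≤)
open import Data.Nat.Properties hiding (_≟_; _≤?_; _<?_)
open import Data.Nat.Tactic.RingSolver using (solve-∀)
open import Data.Product using (_×_; Σ; ∃; _,_; proj₁; proj₂)
open import Data.Sum using (_⊎_; inj₁; inj₂)
open import Data.Vec using (Vec; lookup) renaming ([] to []ᵥ; _∷_ to _∷ᵥ_)
open import Function using (_∘_; id; Equivalence)
open import Relation.Binary.Definitions using (tri<; tri≈; tri>)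
open import Relation.Binary.PropositionalEquality
open import Relation.Nullary using (¬_; Dec; does; yes; no)
open import Relation.Nullary.Decidable using (_×-dec_; _⊎-dec_; dec-true; dec-false)

-- For f(n) = 2n² - 7n + 2 the increments are f(n) - f(n - 1) = 4n - 9 and f(n) - f(n - 2) = 8n -
-- 22. The estimate for an ear with a full hub is exactly 4n - 9: it would leave no strictness, and
-- it would carry along the excess at n = 6, where the triangle with an ear on each side has 33
-- copies while f(6) = 32. Hence a full hub is not counted but placed inside the fan, and every
-- other hub saves one. In the second shape the estimate for one ear can reach 4n - 8, which is too
-- much; but seen from the other ear the ends 0 and 4 exchange their weights, so both deletions
-- together are charged three times the sum of two degrees, and non-crossing bounds that sum by n -
-- 2. The result 7n - 15 is below 8n - 22 from n = 8 on; at n = 8 the excess inherited from n = 6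
-- uses up the margin, so strictness starts at 9. The shapes record missing edges only: the edges 02
-- and 24 may be absent, and no graph is ever triangulated.

module Sum = CommutativeMonoidSum +-0-commutativeMonoid

private variable
  m n : ℕ

-- Sums over vertices and counts of indicator bits

bit : Bool → ℕ
bit false = 0
bit true  = 1

bit≤1 : ∀ b → bit b ≤ 1
bit≤1 false = z≤n
bit≤1 true  = ≤-refl

bit-mono : ∀ {a b} → (a ≡ true → b ≡ true) → bit a ≤ bit b
bit-mono {false} a⇒b = z≤n
bit-mono {true}  a⇒b rewrite a⇒b refl = ≤-refl

bit-cong : ∀ {a b} → (a ≡ true → b ≡ true) → (b ≡ true → a ≡ true) → bit a ≡ bit b
bit-cong a⇒b b⇒a = ≤-antisym (bit-mono a⇒b) (bit-mono b⇒a)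

bit≡0 : ∀ {a} → ¬ a ≡ true → bit a ≡ 0
bit≡0 {false} ¬a = refl
bit≡0 {true}  ¬a = ⊥-elim (¬a refl)

bit-injective : ∀ {a b} → bit a ≡ bit b → a ≡ b
bit-injective {false} {false} _ = refl
bit-injective {true}  {true}  _ = refl

-- Kept opaque so that unification can read the summand off a sum.
opaque
  sum : (Fin n → ℕ) → ℕ
  sum = Sum.sum

  sum-suc : (f : Fin (suc n) → ℕ) → sum f ≡ f fz + sum (f ∘ fs)
  sum-suc f = refl

  sum-cong : ∀ {f g : Fin n → ℕ} → (∀ i → f i ≡ g i) → sum f ≡ sum g
  sum-cong = Sum.sum-cong-≗

  sum-remove : ∀ (v : Fin (suc n)) {f} → sum f ≡ f v + sum (f ∘ punchIn v)
  sum-remove v {f} = Sum.sum-remove {i = v} f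

  sum-comm : (f : Fin m → Fin n → ℕ) → (sum λ i → sum λ j → f i j) ≡ (sum λ j → sum λ i → f i j)
  sum-comm = Sum.∑-comm

  sum-+ : ∀ {f g : Fin n → ℕ} → (sum λ i → f i + g i) ≡ sum f + sum g
  sum-+ {f = f} {g} = Sum.∑-distrib-+ f g

  sum-permute : ∀ (π : Permutation m n) {f} → sum f ≡ sum λ i → f (π ⟨$⟩ʳ i)
  sum-permute π {f} = Sum.sum-permute f π

  sum-mono : ∀ {f g : Fin n → ℕ} → (∀ i → f i ≤ g i) → sum f ≤ sum g
  sum-mono {zero}  f≤g = z≤n
  sum-mono {suc n} f≤g = +-mono-≤ (f≤g fz) (sum-mono (f≤g ∘ fs))

  sum≡0 : ∀ {f : Fin n → ℕ} → (∀ i → f i ≡ 0) → sum f ≡ 0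
  sum≡0 {zero}  f≡0 = refl
  sum≡0 {suc n} f≡0 rewrite f≡0 fz = sum≡0 (f≡0 ∘ fs)

  sum≤* : ∀ {f : Fin n → ℕ} {k} → (∀ i → f i ≤ k) → sum f ≤ n * k
  sum≤* {zero}  f≤k = z≤n
  sum≤* {suc n} f≤k = +-mono-≤ (f≤k fz) (sum≤* (f≤k ∘ fs))

  -- Turns equality of counts into equality of graphs: nested four times inside `E`, it compares two
  -- graphs path by path.
  sum-tight : ∀ {f g : Fin n → ℕ} → (∀ i → f i ≤ g i) → sum f ≡ sum g → ∀ i → f i ≡ g i
  sum-tight {suc n} {f} {g} f≤g Σf≡Σg = λ where
      fz     → f₀≡g₀
      (fs i) → sum-tight (f≤g ∘ fs) (+-cancelˡ-≡ (f fz) _ _ (trans Σf≡Σg (cong (_+ _) (sym f₀≡g₀)))) i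
    where
    f₀≡g₀ : f fz ≡ g fz
    f₀≡g₀ = ≤-antisym (f≤g fz) (+-cancelʳ-≤ (sum (f ∘ fs)) (g fz) (f fz)
      (≤-trans (+-monoʳ-≤ (g fz) (sum-mono (f≤g ∘ fs))) (≤-reflexive (sym Σf≡Σg))))

sum-skip : ∀ (v : Fin (suc n)) {f} → f v ≡ 0 → sum f ≡ sum (f ∘ punchIn v)
sum-skip v {f} fv≡0 = trans (sum-remove v) (cong (_+ sum (f ∘ punchIn v)) fv≡0)

opaque
  unfolding sum

  sum-atMost1 : ∀ {h : Fin n → Bool} →
    (∀ {i j} → i Fin.< j → h i ≡ true → h j ≡ true → ⊥) → sum (bit ∘ h) ≤ 1
  sum-atMost1 {zero} _ = z≤n
  sum-atMost1 {suc n} {h} one with h fz in eq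
  ... | false = sum-atMost1 λ i<j → one (s≤s i<j)
  ... | true  = ≤-reflexive (cong suc (sum≡0 {f = bit ∘ h ∘ fs} λ i → bit≡0 (one (s≤s z≤n) eq)))

  sum-atMost2 : ∀ {h : Fin n → Bool} →
    (∀ {i j k} → i Fin.< j → j Fin.< k → h i ≡ true → h j ≡ true → h k ≡ true → ⊥) → sum (bit ∘ h) ≤ 2
  sum-atMost2 {zero} _ = z≤n
  sum-atMost2 {suc n} {h} two with h fz in eq
  ... | false = sum-atMost2 λ i<j j<k → two (s≤s i<j) (s≤s j<k)
  ... | true  = s≤s (sum-atMost1 λ i<j → two (s≤s z≤n) (s≤s i<j) eq)

  sum-bit≤ : (h : Fin n → Bool) → sum (bit ∘ h) ≤ n
  sum-bit≤ {n} h = subst (sum (bit ∘ h) ≤_) (*-identityʳ n) (sum≤* (bit≤1 ∘ h))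

  -- No index of `g` exceeds an index of `f`, so the two index sets share at most one element. Such
  -- pairs arise as the neighbourhoods of the two ends of a chord, where a violation would be a
  -- crossing.
  sum-threshold : ∀ {f g : Fin n → Bool} →
    (∀ {i j} → i Fin.< j → f i ≡ true → g j ≡ true → ⊥) →
    sum (bit ∘ f) + sum (bit ∘ g) ≤ suc n
  sum-threshold {zero} _ = z≤n
  sum-threshold {suc n} {f} {g} cross with f fz in eq
  ... | true  = begin
    suc (sum (bit ∘ f ∘ fs)) + (bit (g fz) + sum (bit ∘ g ∘ fs))
      ≡⟨ cong (λ s → suc (sum (bit ∘ f ∘ fs)) + (bit (g fz) + s)) (sum≡0 {f = bit ∘ g ∘ fs} λ j → bit≡0 (cross (s≤s z≤n) eq)) ⟩
    suc (sum (bit ∘ f ∘ fs)) + (bit (g fz) + 0)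
      ≤⟨ +-mono-≤ (s≤s (sum-bit≤ (f ∘ fs))) (+-monoˡ-≤ 0 (bit≤1 (g fz))) ⟩
    suc n + 1 ≡⟨ +-comm (suc n) 1 ⟩
    suc (suc n) ∎
    where open ≤-Reasoning
  ... | false = begin
    sum (bit ∘ f ∘ fs) + (bit (g fz) + sum (bit ∘ g ∘ fs)) ≡⟨ lem (sum (bit ∘ f ∘ fs)) (bit (g fz)) _ ⟩
    bit (g fz) + (sum (bit ∘ f ∘ fs) + sum (bit ∘ g ∘ fs))
      ≤⟨ +-mono-≤ (bit≤1 (g fz)) (sum-threshold λ i<j → cross (s≤s i<j)) ⟩
    suc (suc n) ∎
    where
    open ≤-Reasoning
    lem : ∀ a b c → a + (b + c) ≡ b + (a + c)
    lem = solve-∀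

  sum-bit-full : (h : Fin (suc n) → Bool) → (∀ i → h i ≡ true) ⊎ sum (bit ∘ h) ≤ n
  sum-bit-full h with h fz in eq
  ... | false = inj₂ (sum-bit≤ (h ∘ fs))
  sum-bit-full {zero}  h | true = inj₁ λ { fz → eq }
  sum-bit-full {suc n} h | true with sum-bit-full (h ∘ fs)
  ... | inj₁ all = inj₁ λ { fz → eq ; (fs i) → all i }
  ... | inj₂ ≤n  = inj₂ (s≤s ≤n)

-- Copies of P₄

pull : (Fin m → Fin n) → Graph n → Graph m
pull f G = record
  { adj        = λ x y → adj G (f x) (f y)
  ; adj-sym    = λ x y → adj-sym G (f x) (f y)
  ; adj-irrefl = λ x → adj-irrefl G (f x)
  }

_≢ᵇ_ : Fin n → Fin n → Bool
x ≢ᵇ y = not (does (x ≟ y))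

≢ᵇ⇒≢ : ∀ {x y : Fin n} → (x ≢ᵇ y) ≡ true → x ≢ y
≢ᵇ⇒≢ {x = x} {y} p x≡y with x ≟ y
≢ᵇ⇒≢ () x≡y | yes _
... | no x≢y = x≢y x≡y

≢⇒≢ᵇ : ∀ {x y : Fin n} → x ≢ y → (x ≢ᵇ y) ≡ true
≢⇒≢ᵇ {x = x} {y} x≢y = cong not (dec-false (x ≟ y) x≢y)

-- Consecutive vertices differ because there are no loops, so three inequalities suffice.
record IsPath (G : Graph n) (w x y z : Fin n) : Set where
  constructor isPath
  field
    wx  : adj G w x ≡ true
    xy  : adj G x y ≡ true
    yz  : adj G y z ≡ true
    w≢y : w ≢ y
    w≢z : w ≢ z
    x≢z : x ≢ z
open IsPath

path4 : Graph n → (w x y z : Fin n) → Bool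
path4 G w x y z =
  adj G w x ∧ adj G x y ∧ adj G y z ∧ (w ≢ᵇ y) ∧ (w ≢ᵇ z) ∧ (x ≢ᵇ z)

path4⇒ : ∀ (G : Graph n) {w x y z} → path4 G w x y z ≡ true → IsPath G w x y z
path4⇒ G {w} {x} {y} {z} p
  with p₁ ← ∧-conicalʳ (adj G w x) _ p
  with p₂ ← ∧-conicalʳ (adj G x y) _ p₁
  with p₃ ← ∧-conicalʳ (adj G y z) _ p₂
  with p₄ ← ∧-conicalʳ (w ≢ᵇ y) _ p₃
  = isPath (∧-conicalˡ _ _ p) (∧-conicalˡ _ _ p₁) (∧-conicalˡ _ _ p₂)
      (≢ᵇ⇒≢ (∧-conicalˡ _ _ p₃)) (≢ᵇ⇒≢ (∧-conicalˡ _ _ p₄)) (≢ᵇ⇒≢ (∧-conicalʳ (w ≢ᵇ z) _ p₄))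

⇒path4 : ∀ (G : Graph n) {w x y z} → IsPath G w x y z → path4 G w x y z ≡ true
⇒path4 G (isPath wx xy yz w≢y w≢z x≢z)
  rewrite wx | xy | yz | ≢⇒≢ᵇ w≢y | ≢⇒≢ᵇ w≢z | ≢⇒≢ᵇ x≢z = refl

P : Graph n → (w x y z : Fin n) → ℕ
P G w x y z = bit (path4 G w x y z)

P≡0 : ∀ (G : Graph n) {w x y z} → ¬ IsPath G w x y z → P G w x y z ≡ 0
P≡0 G ¬p = bit≡0 (¬p ∘ path4⇒ G)

P≤ : ∀ (G : Graph n) {w x y z b} → (IsPath G w x y z → b ≡ true) → P G w x y z ≤ bit b
P≤ G p⇒b = bit-mono (p⇒b ∘ path4⇒ G)

-- Each copy of P₄ is counted once in each direction, whence the factor 2 in all later bounds.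
E : Graph n → ℕ
E G = sum λ w → sum λ x → sum λ y → sum λ z → P G w x y z

adj-sym-true : ∀ (G : Graph n) {x y} → adj G x y ≡ true → adj G y x ≡ true
adj-sym-true G xy = trans (adj-sym G _ _) xy

adj⇒≢ : ∀ (G : Graph n) {x y} → adj G x y ≡ true → x ≢ y
adj⇒≢ G {x} xy refl with () ← trans (sym xy) (adj-irrefl G x)

IsPath-rev : ∀ (G : Graph n) {w x y z} → IsPath G w x y z → IsPath G z y x w
IsPath-rev G (isPath wx xy yz w≢y w≢z x≢z) =
  isPath (adj-sym-true G yz) (adj-sym-true G xy) (adj-sym-true G wx) (≢-sym x≢z) (≢-sym w≢z) (≢-sym w≢y)

P-rev : ∀ (G : Graph n) w x y z → P G w x y z ≡ P G z y x w
P-rev G w x y z = bit-cong (⇒path4 G ∘ IsPath-rev G ∘ path4⇒ G) (⇒path4 G ∘ IsPath-rev G ∘ path4⇒ G)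

_⊆_ : Graph n → Graph n → Set
G ⊆ H = ∀ x y → adj G x y ≡ true → adj H x y ≡ true

IsPath-mono : ∀ {G H : Graph n} → G ⊆ H → ∀ {w x y z} → IsPath G w x y z → IsPath H w x y z
IsPath-mono G⊆H (isPath wx xy yz w≢y w≢z x≢z) = isPath (G⊆H _ _ wx) (G⊆H _ _ xy) (G⊆H _ _ yz) w≢y w≢z x≢z

P-mono : ∀ {G H : Graph n} → G ⊆ H → ∀ w x y z → P G w x y z ≤ P H w x y z
P-mono {G = G} {H} G⊆H w x y z = bit-mono (⇒path4 H ∘ IsPath-mono {G = G} {H} G⊆H ∘ path4⇒ G)

E-mono : ∀ {G H : Graph n} → G ⊆ H → E G ≤ E H
E-mono {G = G} {H} G⊆H = sum-mono λ w → sum-mono λ x → sum-mono λ y → sum-mono λ z → P-mono {G = G} {H} G⊆H w x y z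

E-tight : ∀ {G H : Graph n} → G ⊆ H → E G ≡ E H → ∀ {w x y z} → IsPath H w x y z → IsPath G w x y z
E-tight {G = G} {H} G⊆H eq {w} {x} {y} {z} p = path4⇒ G (trans (bit-injective P≡P) (⇒path4 H p))
  where
  le = P-mono {G = G} {H} G⊆H
  P≡P : P G w x y z ≡ P H w x y z
  P≡P = sum-tight (le w x y)
    (sum-tight (λ y → sum-mono (le w x y))
    (sum-tight (λ x → sum-mono λ y → sum-mono (le w x y))
    (sum-tight (λ w → sum-mono λ x → sum-mono λ y → sum-mono (le w x y)) eq w) x) y) z

P-pull : ∀ {f : Fin m → Fin n} → (∀ {i j} → f i ≡ f j → i ≡ j) → (G : Graph n) →
  ∀ w x y z → P (pull f G) w x y z ≡ P G (f w) (f x) (f y) (f z)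
P-pull {f = f} inj G w x y z = bit-cong
  (λ p → let isPath wx xy yz a b c = path4⇒ (pull f G) p in
         ⇒path4 G (isPath wx xy yz (a ∘ inj) (b ∘ inj) (c ∘ inj)))
  (λ p → let isPath wx xy yz a b c = path4⇒ G p in
         ⇒path4 (pull f G) (isPath wx xy yz (a ∘ cong f) (b ∘ cong f) (c ∘ cong f)))

perm-injective : ∀ (π : Permutation m n) {i j} → π ⟨$⟩ʳ i ≡ π ⟨$⟩ʳ j → i ≡ j
perm-injective π {i} {j} eq = trans (sym (inverseˡ π)) (trans (cong (π ⟨$⟩ˡ_) eq) (inverseˡ π))

relabel : Permutation′ n → Graph n → Graph n
relabel π = pull (π ⟨$⟩ʳ_)

E-relabel : ∀ (π : Permutation′ n) (G : Graph n) → E (relabel π G) ≡ E G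
E-relabel π G = sym (
  trans (sum-permute π) (sum-cong λ w →
  trans (sum-permute π) (sum-cong λ x →
  trans (sum-permute π) (sum-cong λ y →
  trans (sum-permute π) (sum-cong λ z → sym (P-pull (perm-injective π) G w x y z))))))

-- Deleting a vertex

delete : Fin (suc n) → Graph (suc n) → Graph n
delete v = pull (punchIn v)

endPaths midPaths : Graph (suc n) → Fin (suc n) → ℕ
endPaths G v = sum λ x → sum λ y → sum λ z → P G v (punchIn v x) (punchIn v y) (punchIn v z)
midPaths G v = sum λ w → sum λ y → sum λ z → P G (punchIn v w) v (punchIn v y) (punchIn v z)

-- Each path meets `v` in at most one of its four positions. Reversal matches the fourth position
-- with the first and the third with the second.
E-delete : (G : Graph (suc n)) (v : Fin (suc n)) →
  E G ≡ E (delete v G) + 2 * (endPaths G v + midPaths G v)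
E-delete {n} G v = begin
  E G ≡⟨ sum-remove v ⟩
  (sum λ x → sum λ y → sum λ z → P G v x y z) + (sum λ w → sum λ x → sum λ y → sum λ z → P G (v^ w) x y z)
    ≡⟨ cong₂ _+_ T₁ (trans (sum-cong rest₁) sum-+) ⟩
  endPaths G v + (midPaths G v + (sum λ w → sum λ x → sum λ y → sum λ z → P G (v^ w) (v^ x) y z))
    ≡⟨ cong (λ s → endPaths G v + (midPaths G v + s))
         (trans (sum-cong λ w → trans (sum-cong λ x → rest₂ w x) sum-+) sum-+) ⟩
  endPaths G v + (midPaths G v + ((sum λ w → sum λ x → sum λ z → P G (v^ w) (v^ x) v (v^ z))
                + (sum λ w → sum λ x → sum λ y → sum λ z → P G (v^ w) (v^ x) (v^ y) z)))
    ≡⟨ cong₂ (λ s t → endPaths G v + (midPaths G v + (s + t))) T₃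
         (trans (sum-cong λ w → trans (sum-cong λ x → trans (sum-cong λ y → rest₃ w x y)
           sum-+) sum-+) (trans sum-+ (cong₂ _+_ T₄ T₀))) ⟩
  endPaths G v + (midPaths G v + (midPaths G v + (endPaths G v + E (delete v G))))
    ≡⟨ arith (endPaths G v) (midPaths G v) _ ⟩
  E (delete v G) + 2 * (endPaths G v + midPaths G v) ∎
  where
  open ≡-Reasoning
  v^ : Fin n → Fin (suc n)
  v^ = punchIn v
  arith : ∀ a b c → a + (b + (b + (a + c))) ≡ c + 2 * (a + b)
  arith = solve-∀
  vv : ∀ {x y} → x ≡ v → y ≡ v → ¬ adj G x y ≡ true
  vv refl refl e = adj⇒≢ G e refl
  T₁ : (sum λ x → sum λ y → sum λ z → P G v x y z) ≡ endPaths G v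
  T₁ = trans (sum-skip v (sum≡0 λ y → sum≡0 λ z → P≡0 G λ p → vv refl refl (wx p)))
    (sum-cong λ x → trans (sum-skip v (sum≡0 λ z → P≡0 G λ p → w≢y p refl))
    (sum-cong λ y → sum-skip v (P≡0 G λ p → w≢z p refl)))
  rest₁ : ∀ w → (sum λ x → sum λ y → sum λ z → P G (v^ w) x y z) ≡
    (sum λ y → sum λ z → P G (v^ w) v (v^ y) (v^ z)) + (sum λ x → sum λ y → sum λ z → P G (v^ w) (v^ x) y z)
  rest₁ w = trans (sum-remove v) (cong (_+ (sum λ x → sum λ y → sum λ z → P G (v^ w) (v^ x) y z))
    (trans (sum-skip v (sum≡0 λ z → P≡0 G λ p → vv refl refl (xy p)))
      (sum-cong λ y → sum-skip v (P≡0 G λ p → x≢z p refl))))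
  rest₂ : ∀ w x → (sum λ y → sum λ z → P G (v^ w) (v^ x) y z) ≡
    (sum λ z → P G (v^ w) (v^ x) v (v^ z)) + (sum λ y → sum λ z → P G (v^ w) (v^ x) (v^ y) z)
  rest₂ w x = trans (sum-remove v) (cong (_+ (sum λ y → sum λ z → P G (v^ w) (v^ x) (v^ y) z))
    (sum-skip v (P≡0 G λ p → vv refl refl (yz p))))
  rest₃ : ∀ w x y → (sum λ z → P G (v^ w) (v^ x) (v^ y) z) ≡
    P G (v^ w) (v^ x) (v^ y) v + (sum λ z → P G (v^ w) (v^ x) (v^ y) (v^ z))
  rest₃ w x y = sum-remove v
  T₃ : (sum λ w → sum λ x → sum λ z → P G (v^ w) (v^ x) v (v^ z)) ≡ midPaths G v
  T₃ = trans (sum-cong λ w → sum-comm (λ x z → P G (v^ w) (v^ x) v (v^ z)))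
    (trans (sum-comm (λ w z → sum λ x → P G (v^ w) (v^ x) v (v^ z)))
    (sum-cong λ z → trans (sum-comm (λ w x → P G (v^ w) (v^ x) v (v^ z)))
    (sum-cong λ x → sum-cong λ w → P-rev G (v^ w) (v^ x) v (v^ z))))
  T₄ : (sum λ w → sum λ x → sum λ y → P G (v^ w) (v^ x) (v^ y) v) ≡ endPaths G v
  T₄ = trans (sum-cong λ w → sum-comm (λ x y → P G (v^ w) (v^ x) (v^ y) v))
    (trans (sum-comm (λ w y → sum λ x → P G (v^ w) (v^ x) (v^ y) v))
    (sum-cong λ y → trans (sum-comm (λ w x → P G (v^ w) (v^ x) (v^ y) v))
    (sum-cong λ x → sum-cong λ w → P-rev G (v^ w) (v^ x) (v^ y) v)))
  T₀ : (sum λ w → sum λ x → sum λ y → sum λ z → P G (v^ w) (v^ x) (v^ y) (v^ z)) ≡ E (delete v G)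
  T₀ = sum-cong λ w → sum-cong λ x → sum-cong λ y → sum-cong λ z →
    sym (P-pull (λ {i} {j} → punchIn-injective v i j) G w x y z)

-- Embeddings of P₄ as listed by countEmb

sumOver : ∀ {A : Set} → (A → ℕ) → List A → ℕ
sumOver f []       = 0
sumOver f (x ∷ xs) = f x + sumOver f xs

length-filter : ∀ {A : Set} (p : A → Bool) xs →
  length (filter (λ x → p x Data.Bool.≟ true) xs) ≡ sumOver (bit ∘ p) xs
length-filter p [] = refl
length-filter p (x ∷ xs) with p x
... | true  = cong suc (length-filter p xs)
... | false = length-filter p xs

sumOver-++ : ∀ {A : Set} (f : A → ℕ) xs ys → sumOver f (xs ++ ys) ≡ sumOver f xs + sumOver f ys
sumOver-++ f []       ys = refl
sumOver-++ f (x ∷ xs) ys = trans (cong (f x +_) (sumOver-++ f xs ys)) (sym (+-assoc (f x) _ _))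

sumOver-tabulate : ∀ {A B : Set} (f : A → ℕ) (g : B → A) (h : Fin n → B) →
  sumOver f (map g (tabulate h)) ≡ sum (f ∘ g ∘ h)
sumOver-tabulate {zero}  f g h = sym (sum≡0 λ ())
sumOver-tabulate {suc n} f g h =
  trans (cong (f (g (h fz)) +_) (sumOver-tabulate f g (h ∘ fs))) (sym (sum-suc _))

sumOver-allVecs : ∀ k (f : Vec (Fin n) (suc k) → ℕ) →
  sumOver f (allVecs (suc k) n) ≡ sumOver (λ v → sum λ x → f (x ∷ᵥ v)) (allVecs k n)
sumOver-allVecs {n} k f = go (allVecs k n)
  where
  go : ∀ vs → sumOver f (concatMap (λ v → map (_∷ᵥ v) (allFin n)) vs) ≡ sumOver (λ v → sum λ x → f (x ∷ᵥ v)) vs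
  go []       = refl
  go (v ∷ vs) = trans (sumOver-++ f (map (_∷ᵥ v) (allFin n)) _)
    (cong₂ _+_ (sumOver-tabulate f (_∷ᵥ v) id) (go vs))

allB⇒ : ∀ {A : Set} (p : A → Bool) {xs x} → allB p xs ≡ true → x ∈ xs → p x ≡ true
allB⇒ p {y ∷ xs} all (here refl) = ∧-conicalˡ _ _ all
allB⇒ p {y ∷ xs} all (there x∈)  = allB⇒ p (∧-conicalʳ (p y) _ all) x∈

⇒allB : ∀ {A : Set} (p : A → Bool) xs → (∀ x → p x ≡ true) → allB p xs ≡ true
⇒allB p []       all = refl
⇒allB p (x ∷ xs) all rewrite all x = ⇒allB p xs all

module _ (G : Graph n) (w x y z : Fin n) where
  private
    f : Fin 4 → Fin n
    f = lookup (w ∷ᵥ x ∷ᵥ y ∷ᵥ z ∷ᵥ []ᵥ)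
    ok : Fin 4 → Fin 4 → Bool
    ok i j = (does (i ≟ j) ∨ not (does (f i ≟ f j))) ∧ (not (adj (Path 4) i j) ∨ adj G (f i) (f j))

  embedding⇒path : isEmbedding (Path 4) G f ≡ true → IsPath G w x y z
  embedding⇒path emb = isPath
      (∧-conicalʳ _ _ (at 0F 1F)) (∧-conicalʳ _ _ (at 1F 2F)) (∧-conicalʳ _ _ (at 2F 3F))
      (≢ᵇ⇒≢ (∧-conicalˡ _ _ (at 0F 2F))) (≢ᵇ⇒≢ (∧-conicalˡ _ _ (at 0F 3F))) (≢ᵇ⇒≢ (∧-conicalˡ _ _ (at 1F 3F)))
    where
    at : ∀ i j → ok i j ≡ true
    at i j = allB⇒ (ok i) (allB⇒ (λ i → allB (ok i) (allFin 4)) emb (∈-allFin i)) (∈-allFin j)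

  path⇒embedding : IsPath G w x y z → isEmbedding (Path 4) G f ≡ true
  path⇒embedding (isPath wx xy yz w≢y w≢z x≢z) = ⇒allB _ (allFin 4) λ i → ⇒allB (ok i) (allFin 4) (at i)
    where
    at : ∀ i j → ok i j ≡ true
    at 0F 0F = refl
    at 1F 1F = refl
    at 2F 2F = refl
    at 3F 3F = refl
    at 0F 1F rewrite ≢⇒≢ᵇ (adj⇒≢ G wx) = wx
    at 0F 2F rewrite ≢⇒≢ᵇ w≢y = refl
    at 0F 3F rewrite ≢⇒≢ᵇ w≢z = refl
    at 1F 0F rewrite ≢⇒≢ᵇ (≢-sym (adj⇒≢ G wx)) = adj-sym-true G wx
    at 1F 2F rewrite ≢⇒≢ᵇ (adj⇒≢ G xy) = xy
    at 1F 3F rewrite ≢⇒≢ᵇ x≢z = refl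
    at 2F 0F rewrite ≢⇒≢ᵇ (≢-sym w≢y) = refl
    at 2F 1F rewrite ≢⇒≢ᵇ (≢-sym (adj⇒≢ G xy)) = adj-sym-true G xy
    at 2F 3F rewrite ≢⇒≢ᵇ (adj⇒≢ G yz) = yz
    at 3F 0F rewrite ≢⇒≢ᵇ (≢-sym w≢z) = refl
    at 3F 1F rewrite ≢⇒≢ᵇ (≢-sym x≢z) = refl
    at 3F 2F rewrite ≢⇒≢ᵇ (≢-sym (adj⇒≢ G yz)) = adj-sym-true G yz

-- `allVecs` varies the head fastest, so the sums come out with the last vertex outermost; reading
-- every path backwards restores the order without exchanging sums.
countEmb≡E : (G : Graph n) → countEmb (Path 4) G ≡ E G
countEmb≡E {n} G = begin
  countEmb (Path 4) G               ≡⟨ length-filter emb (allVecs 4 n) ⟩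
  sumOver (bit ∘ emb) (allVecs 4 n) ≡⟨ sumOver-allVecs {n} 3 (bit ∘ emb) ⟩
  sumOver f₃ (allVecs 3 n)          ≡⟨ sumOver-allVecs {n} 2 f₃ ⟩
  sumOver f₂ (allVecs 2 n)          ≡⟨ sumOver-allVecs {n} 1 f₂ ⟩
  sumOver f₁ (allVecs 1 n)          ≡⟨ sumOver-allVecs {n} 0 f₁ ⟩
  (sum λ z → f₁ (z ∷ᵥ []ᵥ)) + 0     ≡⟨ +-identityʳ _ ⟩
  (sum λ z → sum λ y → sum λ x → sum λ w → bit (emb (w ∷ᵥ x ∷ᵥ y ∷ᵥ z ∷ᵥ []ᵥ)))
    ≡⟨ (sum-cong λ z → sum-cong λ y → sum-cong λ x → sum-cong λ w →
         trans (bit-cong (⇒path4 G ∘ embedding⇒path G w x y z) (path⇒embedding G w x y z ∘ path4⇒ G))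
               (P-rev G w x y z)) ⟩
  E G ∎
  where
  open ≡-Reasoning
  emb : Vec (Fin n) 4 → Bool
  emb v = isEmbedding (Path 4) G (lookup v)
  f₃ : Vec (Fin n) 3 → ℕ
  f₃ v = sum λ w → bit (emb (w ∷ᵥ v))
  f₂ : Vec (Fin n) 2 → ℕ
  f₂ v = sum λ x → f₃ (x ∷ᵥ v)
  f₁ : Vec (Fin n) 1 → ℕ
  f₁ v = sum λ y → f₂ (y ∷ᵥ v)

-- The divisor, the number of automorphisms of P₄, evaluates to 2.
copies≡ : (G : Graph n) → copies (Path 4) G ≡ E G / 2
copies≡ G = cong (_/ 2) (countEmb≡E G)

sum-only : ∀ (v : Fin (suc n)) {f} → (∀ j → f (punchIn v j) ≡ 0) → sum f ≡ f v
sum-only v {f} f≡0 = trans (sum-remove v) (trans (cong (f v +_) (sum≡0 f≡0)) (+-identityʳ (f v)))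

sum-*ʳ : ∀ {f : Fin n → ℕ} k → (sum λ i → f i * k) ≡ sum f * k
sum-*ʳ {zero}      k = trans (sum≡0 λ ()) (cong (_* k) (sym (sum≡0 λ ())))
sum-*ʳ {suc n} {f} k = trans (sum-suc _) (trans (cong (f fz * k +_) (sum-*ʳ k))
  (trans (sym (*-distribʳ-+ k (f fz) _)) (cong (_* k) (sym (sum-suc f)))))

sum-const1 : ∀ {f : Fin n → ℕ} → (∀ i → f i ≡ 1) → sum f ≡ n
sum-const1 {zero}  f≡1 = sum≡0 λ ()
sum-const1 {suc n} f≡1 = trans (sum-suc _) (cong₂ _+_ (f≡1 fz) (sum-const1 (f≡1 ∘ fs)))

-- Copies of P₄ in the fan

-- Deleting the end 0 loses only the copy 0123: its single neighbour 1 keeps 0 from being an inner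
-- vertex.
E-path : ∀ k → E (Path (3 + k)) ≡ 2 * k
E-path zero = E≡0
  where
  opaque
    unfolding sum
    E≡0 : E (Path 3) ≡ 0
    E≡0 = refl
E-path (suc k) = begin
  E (Path (4 + k))                        ≡⟨ E-delete (Path (4 + k)) 0F ⟩
  E (Path (3 + k)) + 2 * (endPaths (Path (4 + k)) 0F + midPaths (Path (4 + k)) 0F)
    ≡⟨ cong₂ (λ a b → a + 2 * b) (E-path k) (cong₂ _+_ ends mids) ⟩
  2 * k + 2                               ≡⟨ arith k ⟩
  2 * suc k                               ∎
  where
  open ≡-Reasoning
  G = Path (4 + k)
  arith : ∀ k → 2 * k + 2 ≡ 2 * suc k
  arith = solve-∀
  ends : endPaths G 0F ≡ 1
  ends = trans (sum-only 0F λ x → sum≡0 λ y → sum≡0 λ z → refl)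
    (trans (sum-only 1F λ { 0F → sum≡0 λ z → refl ; (fs y) → sum≡0 λ z → refl })
    (sum-only 2F λ { 0F → refl ; 1F → refl ; (fs (fs z)) → refl }))
  mids : midPaths G 0F ≡ 0
  mids = sum≡0 λ w → sum≡0 λ y → sum≡0 λ z → mid0 w y z
    where
    mid0 : ∀ w y z → P G (fs w) 0F (fs y) (fs z) ≡ 0
    mid0 0F     0F     z = P≡0 G {1F} {0F} {1F} {fs z} λ p → w≢y p refl
    mid0 0F     (fs y) z = refl
    mid0 (fs w) y      z = refl

edges-path : ∀ k → (sum λ y → sum λ z → bit (adj (Path (suc k)) y z)) ≡ 2 * k
edges-path zero = trans (sum-only 0F λ ()) (sum-only 0F λ ())
edges-path (suc k) = begin
  (sum λ y → sum λ z → a y z) ≡⟨ sum-suc _ ⟩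
  (sum λ z → a 0F z) + (sum λ y → sum λ z → a (fs y) z)
    ≡⟨ cong₂ _+_ (sum-only 1F λ { 0F → refl ; (fs z) → refl })
        (trans (sum-cong λ y → sum-suc _) sum-+) ⟩
  1 + ((sum λ y → a (fs y) 0F) + (sum λ y → sum λ z → a (fs y) (fs z)))
    ≡⟨ cong₂ (λ s t → 1 + (s + t)) (sum-only 0F λ y → refl) (edges-path k) ⟩
  1 + (1 + 2 * k) ≡⟨ arith k ⟩
  2 * suc k ∎
  where
  open ≡-Reasoning
  a : Fin (2 + k) → Fin (2 + k) → ℕ
  a y z = bit (adj (Path (2 + k)) y z)
  arith : ∀ k → 1 + (1 + 2 * k) ≡ 2 * suc k
  arith = solve-∀

sum-avoid2 : ∀ {y z : Fin (2 + n)} → y ≢ z → (sum λ w → bit ((w ≢ᵇ y) ∧ (w ≢ᵇ z) ∧ true)) ≡ n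
sum-avoid2 {n} {y} {z} y≢z = trans (sum-skip y (bit≡0 λ e → ≢ᵇ⇒≢ {x = y} (∧-conicalˡ _ _ e) refl))
  (trans (sum-skip z′ (bit≡0 λ e → ≢ᵇ⇒≢ {x = punchIn y z′} (∧-conicalˡ _ _ (∧-conicalʳ (punchIn y z′ ≢ᵇ y) _ e)) (punchIn-punchOut y≢z)))
  (sum-const1 ones))
  where
  z′ = punchOut y≢z
  ones : ∀ j → bit ((punchIn y (punchIn z′ j) ≢ᵇ y) ∧ (punchIn y (punchIn z′ j) ≢ᵇ z) ∧ true) ≡ 1
  ones j rewrite ≢⇒≢ᵇ (punchInᵢ≢i y (punchIn z′ j))
    | ≢⇒≢ᵇ {x = punchIn y (punchIn z′ j)} {z} (λ eq → punchInᵢ≢i z′ j (punchIn-injective y _ _ (trans eq (sym (punchIn-punchOut y≢z)))))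
    = refl

-- A path `w 0 y z` is a directed rim edge `y z`, in 2(k + 1) ways, together with one of the k rim
-- vertices off that edge.
midPaths-fan : ∀ k → midPaths (Fan (3 + k)) 0F ≡ 2 * suc k * k
midPaths-fan k = begin
  (sum λ w → sum λ y → sum λ z → p w y z)    ≡⟨ sum-comm (λ w y → sum λ z → p w y z) ⟩
  (sum λ y → sum λ w → sum λ z → p w y z)    ≡⟨ (sum-cong λ y → sum-comm (λ w z → p w y z)) ⟩
  (sum λ y → sum λ z → sum λ w → p w y z)    ≡⟨ (sum-cong λ y → sum-cong λ z → inner y z) ⟩
  (sum λ y → sum λ z → a y z * k)            ≡⟨ (sum-cong λ y → sum-*ʳ k) ⟩
  (sum λ y → (sum λ z → a y z) * k)          ≡⟨ sum-*ʳ k ⟩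
  (sum λ y → sum λ z → a y z) * k            ≡⟨ cong (_* k) (edges-path (suc k)) ⟩
  2 * suc k * k ∎
  where
  open ≡-Reasoning
  p : (w y z : Fin (2 + k)) → ℕ
  p w y z = P (Fan (3 + k)) (fs w) 0F (fs y) (fs z)
  a : (y z : Fin (2 + k)) → ℕ
  a y z = bit (adj (Path (2 + k)) y z)
  inner : ∀ y z → (sum λ w → p w y z) ≡ a y z * k
  inner y z with nbrℕ (toℕ y) (toℕ z) in eq
  ... | false = sum≡0 λ w → refl
  ... | true  = trans (sum-avoid2 {y = y} {z} (adj⇒≢ (Path (2 + k)) eq)) (sym (+-identityʳ k))

-- These are the directed three-vertex paths of the rim; the first rim vertex lies on one of them in
-- each direction.
endPaths-fan : ∀ k → endPaths (Fan (3 + k)) 0F ≡ 2 * k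
endPaths-fan zero = ends≡0
  where
  opaque
    unfolding sum
    ends≡0 : endPaths (Fan 3) 0F ≡ 0
    ends≡0 = refl
endPaths-fan (suc k) = begin
  (sum λ x → sum λ y → sum λ z → p x y z)      ≡⟨ sum-suc _ ⟩
  (sum λ y → sum λ z → p 0F y z) + (sum λ x → sum λ y → sum λ z → p (fs x) y z)
    ≡⟨ cong₂ _+_
        (trans (sum-only 1F λ { 0F → sum≡0 λ z → refl ; (fs y) → sum≡0 λ z → refl })
          (sum-only 2F λ { 0F → refl ; 1F → refl ; (fs (fs z)) → refl }))
        (sum-cong λ x → trans (trans (sum-suc _) (cong (_+ (sum λ y → sum λ z → p (fs x) (fs y) z)) (sum≡0 λ z → mid0 x z)))
           (trans (sum-cong λ y → sum-suc _) sum-+)) ⟩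
  1 + (sum λ x → (sum λ y → p (fs x) (fs y) 0F) + (sum λ y → sum λ z → p (fs x) (fs y) (fs z)))
    ≡⟨ cong (1 +_) sum-+ ⟩
  1 + ((sum λ x → sum λ y → p (fs x) (fs y) 0F) + endPaths (Fan (3 + k)) 0F)
    ≡⟨ cong₂ (λ s t → 1 + (s + t))
         (trans (sum-only 1F λ x → sum≡0 λ y → end0 x y) (sum-only 0F λ y → P≡0 G {0F} {3F} {fs (fs (fs y))} {1F} λ p → no-end y (yz p)))
         (endPaths-fan k) ⟩
  1 + (1 + 2 * k) ≡⟨ arith k ⟩
  2 * suc k ∎
  where
  open ≡-Reasoning
  G = Fan (4 + k)
  p : (x y z : Fin (3 + k)) → ℕ
  p x y z = P G 0F (fs x) (fs y) (fs z)
  arith : ∀ k → 1 + (1 + 2 * k) ≡ 2 * suc k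
  arith = solve-∀
  mid0 : ∀ x z → p (fs x) 0F z ≡ 0
  mid0 0F 0F = refl
  mid0 0F 1F = refl
  mid0 0F (fs (fs z)) = refl
  mid0 (fs x) z = refl
  no-end : ∀ y → ¬ nbrℕ (2 + toℕ {1 + k} y) 0 ≡ true
  no-end y ()
  end0 : ∀ x y → p (fs (punchIn 1F x)) (fs y) 0F ≡ 0
  end0 0F 0F = refl
  end0 (fs x) 0F = refl
  end0 x (fs y) = P≡0 G {0F} {fs (fs (punchIn 1F x))} {fs (fs (fs y))} {1F} λ p → no-end y (yz p)

-- The bracket is 2n² - 7n + 2 at n = 4 + k, written without subtraction.
E-fan : ∀ k → E (Fan (4 + k)) ≡ 2 * (6 + 9 * k + 2 * (k * k))
E-fan k = begin
  E (Fan (4 + k)) ≡⟨ E-delete (Fan (4 + k)) 0F ⟩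
  E (Path (3 + k)) + 2 * (endPaths (Fan (4 + k)) 0F + midPaths (Fan (4 + k)) 0F)
    ≡⟨ cong₂ (λ s t → s + 2 * t) (E-path k) (cong₂ _+_ (endPaths-fan (suc k)) (midPaths-fan (suc k))) ⟩
  2 * k + 2 * (2 * suc k + 2 * suc (suc k) * suc k) ≡⟨ arith k ⟩
  2 * (6 + 9 * k + 2 * (k * k)) ∎
  where
  open ≡-Reasoning
  arith : ∀ k → 2 * k + 2 * (2 * suc k + 2 * suc (suc k) * suc k) ≡ 2 * (6 + 9 * k + 2 * (k * k))
  arith = solve-∀

-- Copies of P₄ through an ear

sum-≤ : ∀ {f : Fin (suc n) → ℕ} {a b} → f fz ≤ a → sum (f ∘ fs) ≤ b → sum f ≤ a + b
sum-≤ {f = f} p q = ≤-trans (≤-reflexive (sum-suc f)) (+-mono-≤ p q)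

sum≤0 : ∀ {f : Fin n → ℕ} → (∀ i → f i ≡ 0) → sum f ≤ 0
sum≤0 f≡0 = ≤-reflexive (sum≡0 f≡0)

NonCrossing : Graph n → Set
NonCrossing G = ∀ {u x v y} → u Fin.< x → x Fin.< v → v Fin.< y →
  adj G u v ≡ true → adj G x y ≡ true → ⊥

false⇒¬true : ∀ {b} → b ≡ false → ¬ b ≡ true
false⇒¬true refl ()

-- A path through an ear 1 on the edge 02 leaves it via 0 or via 2; outer and inner count the
-- ways to go on from 0 and from 2, respectively, to some y ≥ 3 and then to a further vertex.
module _ (G : Graph (3 + m)) where
  hubDeg midDeg outer inner : ℕ
  hubDeg = sum λ k → bit (adj G 0F (fs (fs (fs k))))
  midDeg = sum λ k → bit (adj G 2F (fs (fs (fs k))))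
  outer  = sum λ k → sum λ j → bit (adj G 0F (fs (fs (fs k))) ∧ adj G (fs (fs (fs k))) (fs (fs j)))
  inner  = sum λ k → bit (adj G 2F (fs (fs (fs k))) ∧ adj G (fs (fs (fs k))) 0F)
                   + (sum λ j → bit (adj G 2F (fs (fs (fs k))) ∧ adj G (fs (fs (fs k))) (fs (fs (fs j)))))

  module _ (ear : ∀ k → adj G 1F (fs (fs (fs k))) ≡ false) where
    private
      ∧-intro : ∀ {a b} → a ≡ true → b ≡ true → a ∧ b ≡ true
      ∧-intro refl refl = refl

      far : ∀ k {A : Set} → adj G 1F (fs (fs (fs k))) ≡ true → A
      far k e = ⊥-elim (false⇒¬true (ear k) e)

      far′ : ∀ k {A : Set} → adj G (fs (fs (fs k))) 1F ≡ true → A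
      far′ k e = far k (adj-sym-true G e)

      loop : ∀ {x} {A : Set} → adj G x x ≡ true → A
      loop e = ⊥-elim (adj⇒≢ G e refl)

      viaHub : (sum λ y → sum λ z → P G 1F 0F (punchIn 1F y) (punchIn 1F z)) ≤ 0 + (midDeg + outer)
      viaHub = sum-≤ (sum≤0 λ z → P≡0 G {1F} {0F} {0F} λ p → loop (xy p))
        (sum-≤ (sum-≤ {a = 0} (≤-reflexive (P≡0 G {1F} {0F} {2F} {0F} λ p → x≢z p refl))
               (sum-≤ {a = 0} (≤-reflexive (P≡0 G {1F} {0F} {2F} {2F} λ p → loop (yz p)))
               (sum-mono λ k → P≤ G {1F} {0F} {2F} {fs (fs (fs k))} yz)))
        (sum-mono λ k → sum-≤ {a = 0} (≤-reflexive (P≡0 G {1F} {0F} {fs (fs (fs k))} {0F} λ p → x≢z p refl))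
          (sum-mono λ j → P≤ G {1F} {0F} {fs (fs (fs k))} {fs (fs j)} λ p → ∧-intro (xy p) (yz p))))

      viaMid : (sum λ y → sum λ z → P G 1F 2F (punchIn 1F y) (punchIn 1F z)) ≤ hubDeg + (0 + inner)
      viaMid = sum-≤ (sum-≤ {a = 0} (≤-reflexive (P≡0 G {1F} {2F} {0F} {0F} λ p → loop (yz p)))
               (sum-≤ {a = 0} (≤-reflexive (P≡0 G {1F} {2F} {0F} {2F} λ p → x≢z p refl))
               (sum-mono λ k → P≤ G {1F} {2F} {0F} {fs (fs (fs k))} yz)))
        (sum-≤ (sum≤0 λ z → P≡0 G {1F} {2F} {2F} λ p → loop (xy p))
        (sum-mono λ k → sum-≤ (P≤ G {1F} {2F} {fs (fs (fs k))} {0F} λ p → ∧-intro (xy p) (yz p))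
           (sum-≤ {a = 0} (≤-reflexive (P≡0 G {1F} {2F} {fs (fs (fs k))} {2F} λ p → x≢z p refl))
          (sum-mono λ j → P≤ G {1F} {2F} {fs (fs (fs k))} {fs (fs (fs j))} λ p → ∧-intro (xy p) (yz p)))))

      ends : endPaths G 1F ≤ (0 + (midDeg + outer)) + ((hubDeg + (0 + inner)) + 0)
      ends = sum-≤ viaHub (sum-≤ viaMid (sum≤0 λ x → sum≡0 λ y → sum≡0 λ z →
        P≡0 G {1F} {fs (fs (fs x))} λ p → far x (wx p)))

      mids : midPaths G 1F ≤ (0 + (midDeg + 0)) + (hubDeg + 0 + 0)
      mids = sum-≤
        (sum-≤ (sum≤0 λ z → P≡0 G {0F} {1F} {0F} λ p → w≢y p refl)
        (sum-≤ (sum-≤ {a = 0} (≤-reflexive (P≡0 G {0F} {1F} {2F} {0F} λ p → w≢z p refl))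
               (sum-≤ {a = 0} (≤-reflexive (P≡0 G {0F} {1F} {2F} {2F} λ p → loop (yz p)))
               (sum-mono λ k → P≤ G {0F} {1F} {2F} {fs (fs (fs k))} yz)))
        (sum≤0 λ y → sum≡0 λ z → P≡0 G {0F} {1F} {fs (fs (fs y))} λ p → far y (xy p))))
        (sum-≤
        (sum-≤ (sum-≤ {a = 0} (≤-reflexive (P≡0 G {2F} {1F} {0F} {0F} λ p → loop (yz p)))
               (sum-≤ {a = 0} (≤-reflexive (P≡0 G {2F} {1F} {0F} {2F} λ p → w≢z p refl))
               (sum-mono λ k → P≤ G {2F} {1F} {0F} {fs (fs (fs k))} yz)))
        (sum-≤ {a = 0} (sum≤0 λ z → P≡0 G {2F} {1F} {2F} λ p → w≢y p refl)
        (sum≤0 λ y → sum≡0 λ z → P≡0 G {2F} {1F} {fs (fs (fs y))} λ p → far y (xy p))))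
        (sum≤0 λ w → sum≡0 λ y → sum≡0 λ z → P≡0 G {fs (fs (fs w))} {1F} λ p → far′ w (wx p)))

    -- The paths `1 2 0 y` and `2 1 0 y` give twice `hubDeg`, the paths `1 0 2 y` and `0 1 2 y`
    -- twice `midDeg`. It is an inequality because the edges 01, 12 and 02 may be missing.
    E-delete-ear : E G ≤ E (delete 1F G) + 2 * (2 * hubDeg + 2 * midDeg + outer + inner)
    E-delete-ear = ≤-trans (≤-reflexive (E-delete G 1F))
      (+-monoʳ-≤ (E (delete 1F G)) (*-monoʳ-≤ 2
        (≤-trans (+-mono-≤ ends mids) (≤-reflexive (arith hubDeg midDeg outer inner)))))
      where
      arith : ∀ d b s c → ((0 + (b + s)) + ((d + (0 + c)) + 0)) + ((0 + (b + 0)) + (d + 0 + 0)) ≡ 2 * d + 2 * b + s + c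
      arith = solve-∀

-- Common neighbours in a non-crossing graph

sum-last≤ : ∀ {f : Fin (suc n) → ℕ} → (∀ i → f i ≤ 2) → f (fromℕ n) ≤ 1 → sum f ≤ 1 + n * 2
sum-last≤ {n} f≤2 last≤1 = ≤-trans (≤-reflexive (sum-remove (fromℕ n)))
  (+-mono-≤ last≤1 (sum≤* λ i → f≤2 (punchIn (fromℕ n) i)))

codegree : Graph (3 + m) → Fin (3 + m) → ℕ
codegree G z = sum λ k → bit (adj G 0F (fs (fs (fs k))) ∧ adj G (fs (fs (fs k))) z)

-- Double counting: the walks `0 y z` are grouped by their end `z`.
outer≡ : (G : Graph (3 + m)) → outer G ≡ sum λ j → codegree G (fs (fs j))
outer≡ G = sum-comm λ k j → bit (adj G 0F (fs (fs (fs k))) ∧ adj G (fs (fs (fs k))) (fs (fs j)))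

module _ (G : Graph (3 + m)) (nc : NonCrossing G) where
  private
    common : Fin (3 + m) → Fin m → Bool
    common z k = adj G 0F (fs (fs (fs k))) ∧ adj G (fs (fs (fs k))) z

    hub : ∀ z k → common z k ≡ true → adj G 0F (fs (fs (fs k))) ≡ true
    hub z k = ∧-conicalˡ _ _

    tip : ∀ z k → common z k ≡ true → adj G (fs (fs (fs k))) z ≡ true
    tip z k = ∧-conicalʳ (adj G 0F (fs (fs (fs k)))) _

    right : ∀ z {i j} → fz {2 + m} Fin.< z → z Fin.< fs (fs (fs i)) → i Fin.< j →
      common z i ≡ true → common z j ≡ true → ⊥
    right z {i} {j} 0<z z<i i<j ci cj =
      nc 0<z z<i (s≤s (s≤s (s≤s i<j))) (hub z i ci) (adj-sym-true G (tip z j cj))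

    left : ∀ z {i j} → fs (fs (fs j)) Fin.< z → i Fin.< j → common z i ≡ true → common z j ≡ true → ⊥
    left z {i} {j} j<z i<j ci cj =
      nc (s≤s z≤n) (s≤s (s≤s (s≤s i<j))) j<z (hub z j cj) (tip z i ci)

  -- Two common neighbours of 0 and `z` on the same side of `z` produce crossing chords. Of three,
  -- the middle one shares its side of `z` with one of the others.
  codegree≤2 : ∀ z → fz {2 + m} Fin.< z → codegree G z ≤ 2
  codegree≤2 z 0<z = sum-atMost2 λ {i} {j} {k} i<j j<k ci cj ck → cases i<j j<k ci cj ck
    where
    cases : ∀ {i j k} → i Fin.< j → j Fin.< k → common z i ≡ true → common z j ≡ true → common z k ≡ true → ⊥
    cases {i} {j} i<j j<k ci cj ck with Finₚ.<-cmp (fs (fs (fs j))) z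
    ... | tri< j<z _ _ = left z j<z i<j ci cj
    ... | tri≈ _ refl _ = adj⇒≢ G (tip z j cj) refl
    ... | tri> _ _ z<j = right z 0<z z<j j<k cj ck

  codegree-right : ∀ z → fz {2 + m} Fin.< z → (∀ k → common z k ≡ true → z Fin.< fs (fs (fs k))) → codegree G z ≤ 1
  codegree-right z 0<z z<c = sum-atMost1 λ {i} i<j ci cj → right z 0<z (z<c i ci) i<j ci cj

  codegree-top : ∀ z → (∀ y → y Fin.≤ z) → codegree G z ≤ 1
  codegree-top z top = sum-atMost1 λ {i} {j} i<j ci cj →
    left z (Finₚ.≤∧≢⇒< (top _) (adj⇒≢ G (tip z j cj))) i<j ci cj

-- An end `z` counts at most twice, but 2 and 3 have no counted neighbour on their left and the last
-- vertex has none on its right, so these count once. For m = 0 the vertex 3 is also the last one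
-- and counts not at all.
outer≤ : (G : Graph (4 + m)) → NonCrossing G → outer G ≤ 1 + 2 * m
outer≤ {m} G nc = ≤-trans (≤-reflexive (outer≡ G)) (sum-≤ σ₂ (rest G nc))
  where
  σ₂ : codegree G 2F ≤ 1
  σ₂ = codegree-right G nc 2F (s≤s z≤n) λ k _ → s≤s (s≤s (s≤s z≤n))
  rest : ∀ {m} (G : Graph (4 + m)) (nc : NonCrossing G) → (sum λ j → codegree G (fs (fs (fs j)))) ≤ 2 * m
  rest {zero} G nc = sum-≤ {a = 0} (sum≤0 λ { 0F → bit≡0 λ c → adj⇒≢ G (∧-conicalʳ (adj G 0F 3F) _ c) refl }) (sum≤0 λ ())
  rest {suc m} G nc = ≤-trans (sum-≤ σ₃ (sum-last≤ (λ j → codegree≤2 G nc _ (s≤s z≤n))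
      (codegree-top G nc _ ≤fromℕ))) (≤-reflexive (arith m))
    where
    arith : ∀ m → 1 + (1 + m * 2) ≡ 2 * suc m
    arith = solve-∀
    σ₃ : codegree G 3F ≤ 1
    σ₃ = codegree-right G nc 3F (s≤s z≤n) λ where
      0F c     → ⊥-elim (adj⇒≢ G (∧-conicalʳ (adj G 0F 3F) _ c) refl)
      (fs k) _ → s≤s (s≤s (s≤s (s≤s z≤n)))

-- Without the edge 03 the vertex 4, too, has no counted neighbour on its left; this saves one
-- against the general bound 3 + 2m.
outer₄≤ : (G : Graph (5 + m)) → NonCrossing G → adj G 0F 3F ≡ false → outer G ≤ 2 + 2 * m
outer₄≤ {m} G nc no03 = ≤-trans (≤-reflexive (outer≡ G)) (sum-≤ {a = 1} σ₂ (sum-≤ {a = 1} σ₃ (rest G nc no03)))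
  where
  σ₂ : codegree G 2F ≤ 1
  σ₂ = codegree-right G nc 2F (s≤s z≤n) λ k _ → s≤s (s≤s (s≤s z≤n))
  σ₃ : codegree G 3F ≤ 1
  σ₃ = codegree-right G nc 3F (s≤s z≤n) λ where
    0F c     → ⊥-elim (false⇒¬true no03 (∧-conicalˡ _ _ c))
    (fs k) _ → s≤s (s≤s (s≤s (s≤s z≤n)))
  rest : ∀ {m} (G : Graph (5 + m)) (nc : NonCrossing G) → adj G 0F 3F ≡ false →
    (sum λ j → codegree G (fs (fs (fs (fs j))))) ≤ 2 * m
  rest {zero} G nc no03 = sum-≤ {a = 0} (sum≤0 λ where
      0F → bit≡0 λ c → false⇒¬true no03 (∧-conicalˡ _ _ c)
      1F → bit≡0 λ c → adj⇒≢ G (∧-conicalʳ (adj G 0F 4F) _ c) refl) (sum≤0 λ ())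
  rest {suc m} G nc no03 = ≤-trans (sum-≤ σ₄ (sum-last≤ (λ j → codegree≤2 G nc _ (s≤s z≤n))
      (codegree-top G nc _ ≤fromℕ))) (≤-reflexive (arith m))
    where
    arith : ∀ m → 1 + (1 + m * 2) ≡ 2 * suc m
    arith = solve-∀
    σ₄ : codegree G 4F ≤ 1
    σ₄ = codegree-right G nc 4F (s≤s z≤n) λ where
      0F c          → ⊥-elim (false⇒¬true no03 (∧-conicalˡ _ _ c))
      1F c          → ⊥-elim (adj⇒≢ G (∧-conicalʳ (adj G 0F 4F) _ c) refl)
      (fs (fs k)) _ → s≤s (s≤s (s≤s (s≤s (s≤s z≤n))))

-- The edge 03 (virtually) cuts off the vertices 1 and 2, and the ear 1 hangs on the edge 02.
record Ear (G : Graph (4 + m)) : Set where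
  field
    ear₁ : ∀ k → adj G 1F (fs (fs (fs k))) ≡ false
    ear₂ : ∀ k → adj G 2F (fs (fs (fs (fs k)))) ≡ false

-- The edge 04 (virtually) cuts off the vertices 1, 2 and 3, with ears 1 and 3 on the edges 02 and 24.
record TwoEars (G : Graph (5 + m)) : Set where
  field
    ear₁ : ∀ k → adj G 1F (fs (fs (fs k))) ≡ false
    ear₂ : ∀ k → adj G 2F (fs (fs (fs (fs (fs k))))) ≡ false
    ear₃ : ∀ k → adj G 3F (fs (fs (fs (fs (fs k))))) ≡ false
    ear₀ : adj G 3F 0F ≡ false

-- Counts the continuations of a path `1 2 3`: the neighbours of 3 other than 1 and 2. The summand
-- for 3 itself is zero.
cornerDeg : Graph (4 + m) → ℕ
cornerDeg G = bit (adj G 3F 0F) + sum λ j → bit (adj G 3F (fs (fs (fs j))))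

module _ (G : Graph (4 + m)) (nc : NonCrossing G) (e : Ear G) where
  open Ear e
  private
    mid≤ : midDeg G ≤ 1 + 0
    mid≤ = sum-≤ (bit≤1 _) (sum≤0 λ k → cong bit (ear₂ k))

    inner≤ : inner G ≤ cornerDeg G + 0
    inner≤ = sum-≤ (+-mono-≤ (bit-mono (∧-conicalʳ (adj G 2F 3F) _)) (sum-mono λ j → bit-mono (∧-conicalʳ (adj G 2F 3F) _)))
      (sum≤0 λ k → cong₂ _+_ (none k) (sum≡0 λ j → none k))
      where
      none : ∀ k {b} → bit (adj G 2F (fs (fs (fs (fs k)))) ∧ b) ≡ 0
      none k rewrite ear₂ k = refl

  E-Ear≤ : E G ≤ E (delete 1F G) + 2 * (3 + 2 * m + 2 * hubDeg G + cornerDeg G)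
  E-Ear≤ = ≤-trans (E-delete-ear G ear₁) (+-monoʳ-≤ (E (delete 1F G)) (*-monoʳ-≤ 2
    (≤-trans (+-mono-≤ (+-mono-≤ (+-monoʳ-≤ (2 * hubDeg G) (*-monoʳ-≤ 2 mid≤)) (outer≤ G nc)) inner≤)
      (≤-reflexive (arith (hubDeg G) (cornerDeg G) m)))))
    where
    arith : ∀ d c m → 2 * d + 2 * (1 + 0) + (1 + 2 * m) + (c + 0) ≡ 3 + 2 * m + 2 * d + c
    arith = solve-∀

  -- For 3 < i < j the chords from 0 to i and from 3 to j cross, so the two neighbourhoods beyond 3
  -- share at most one vertex; the edge 03 is counted from both of its ends.
  hub+corner≤ : hubDeg G + cornerDeg G ≤ 3 + m
  hub+corner≤ = begin
    hubDeg G + cornerDeg G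
      ≡⟨ cong₂ (λ a b → a + (bit (adj G 3F 0F) + b)) (sum-suc _) (sum-suc _) ⟩
    (bit (adj G 0F 3F) + f) + (bit (adj G 3F 0F) + (bit (adj G 3F 3F) + g))
      ≡⟨ cong (λ b → (bit (adj G 0F 3F) + f) + (bit (adj G 3F 0F) + (bit b + g))) (adj-irrefl G 3F) ⟩
    (bit (adj G 0F 3F) + f) + (bit (adj G 3F 0F) + g)
      ≡⟨ arith (bit (adj G 0F 3F)) f (bit (adj G 3F 0F)) g ⟩
    bit (adj G 0F 3F) + bit (adj G 3F 0F) + (f + g)
      ≤⟨ +-mono-≤ (+-mono-≤ (bit≤1 (adj G 0F 3F)) (bit≤1 (adj G 3F 0F)))
          (sum-threshold λ i<j e₁ e₂ → nc (s≤s z≤n) (s≤s (s≤s (s≤s (s≤s z≤n)))) (s≤s (s≤s (s≤s (s≤s i<j)))) e₁ e₂) ⟩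
    3 + m ∎
    where
    open ≤-Reasoning
    f g : ℕ
    f = sum λ k → bit (adj G 0F (fs (fs (fs (fs k)))))
    g = sum λ k → bit (adj G 3F (fs (fs (fs (fs k)))))
    arith : ∀ a f b g → (a + f) + (b + g) ≡ a + b + (f + g)
    arith = solve-∀

-- Degrees of 0 and 4 outside 1, 2, 3. The two formulas mirror each other, so the reflection
-- exchanging 0 and 4 exchanges them.
hubDeg₄ cornerDeg₄ : Graph (5 + m) → ℕ
hubDeg₄ G    = bit (adj G 0F 4F) + sum λ k → bit (adj G 0F (fs (fs (fs (fs (fs k))))))
cornerDeg₄ G = bit (adj G 4F 0F) + sum λ k → bit (adj G 4F (fs (fs (fs (fs (fs k))))))

module _ (G : Graph (5 + m)) (nc : NonCrossing G) (e : TwoEars G) where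
  open TwoEars e

  private
    ear₀′ : adj G 0F 3F ≡ false
    ear₀′ = trans (adj-sym G 0F 3F) ear₀

    hub≤ : hubDeg G ≤ 0 + hubDeg₄ G
    hub≤ = sum-≤ (≤-reflexive (cong bit ear₀′)) (≤-reflexive (sum-suc _))

    mid≤ : midDeg G ≤ 1 + (1 + 0)
    mid≤ = sum-≤ (bit≤1 _) (sum-≤ (bit≤1 _) (sum≤0 λ k → cong bit (ear₂ k)))

    inner≤ : inner G ≤ (0 + (0 + (1 + 0))) + ((bit (adj G 4F 0F) + (1 + (0 + sum λ k → bit (adj G 4F (fs (fs (fs (fs (fs k)))))))))  + 0)
    inner≤ = sum-≤ (+-mono-≤ (≤-reflexive (bit≡0 λ t → false⇒¬true ear₀ (∧-conicalʳ (adj G 2F 3F) _ t)))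
          (sum-≤ (≤-reflexive (bit≡0 λ t → adj⇒≢ G (∧-conicalʳ (adj G 2F 3F) _ t) refl))
            (sum-≤ (bit≤1 _) (sum≤0 λ k → bit≡0 λ t → false⇒¬true (ear₃ k) (∧-conicalʳ (adj G 2F 3F) _ t)))))
      (sum-≤ (+-mono-≤ (bit-mono (∧-conicalʳ (adj G 2F 4F) _))
          (sum-≤ (bit≤1 _) (sum-≤ (≤-reflexive (bit≡0 λ t → adj⇒≢ G (∧-conicalʳ (adj G 2F 4F) _ t) refl))
             (sum-mono λ k → bit-mono (∧-conicalʳ (adj G 2F 4F) _)))))
      (sum≤0 λ k → cong₂ _+_ (none k) (sum≡0 λ j → none k)))
      where
      none : ∀ k {b} → bit (adj G 2F (fs (fs (fs (fs (fs k))))) ∧ b) ≡ 0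
      none k rewrite ear₂ k = refl

  -- In the constant 8, twice `midDeg` (neighbours 3 and 4) gives 4, `outer` gives 2, and the paths
  -- `1 2 3 4` and `1 2 4 3` give 1 each.
  E-TwoEars≤ : E G ≤ E (delete 1F G) + 2 * (8 + 2 * m + 2 * hubDeg₄ G + cornerDeg₄ G)
  E-TwoEars≤ = ≤-trans (E-delete-ear G ear₁) (+-monoʳ-≤ (E (delete 1F G)) (*-monoʳ-≤ 2
    (≤-trans (+-mono-≤ (+-mono-≤ (+-mono-≤ (*-monoʳ-≤ 2 hub≤) (*-monoʳ-≤ 2 mid≤)) (outer₄≤ G nc ear₀′)) inner≤)
      (≤-reflexive (arith (hubDeg₄ G) m (bit (adj G 4F 0F)) _)))))
    where
    arith : ∀ d m c g → 2 * (0 + d) + 2 * (1 + (1 + 0)) + (2 + 2 * m) + ((0 + (0 + (1 + 0))) + ((c + (1 + (0 + g))) + 0))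
      ≡ 8 + 2 * m + 2 * d + (c + g)
    arith = solve-∀

  hub+corner₄≤ : hubDeg₄ G + cornerDeg₄ G ≤ 3 + m
  hub+corner₄≤ = begin
    hubDeg₄ G + cornerDeg₄ G ≡⟨ arith (bit (adj G 0F 4F)) _ (bit (adj G 4F 0F)) _ ⟩
    bit (adj G 0F 4F) + bit (adj G 4F 0F) + ((sum λ k → bit (adj G 0F (fs (fs (fs (fs (fs k)))))))
                                           + (sum λ k → bit (adj G 4F (fs (fs (fs (fs (fs k))))))))
      ≤⟨ +-mono-≤ (+-mono-≤ (bit≤1 (adj G 0F 4F)) (bit≤1 (adj G 4F 0F)))
          (sum-threshold λ i<j e₁ e₂ → nc (s≤s z≤n) (s≤s (s≤s (s≤s (s≤s (s≤s z≤n))))) (s≤s (s≤s (s≤s (s≤s (s≤s i<j))))) e₁ e₂) ⟩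
    3 + m ∎
    where
    open ≤-Reasoning
    arith : ∀ a f b g → (a + f) + (b + g) ≡ a + b + (f + g)
    arith = solve-∀

-- Finding an ear

-- Adjacency on numerical positions, so that offsets such as 2 + k need no bound of their own.
Joined : Graph n → ℕ → ℕ → Set
Joined G x y = ∃ λ i → ∃ λ j → toℕ i ≡ x × toℕ j ≡ y × adj G i j ≡ true

-- Positions are relative to `k`. In `mirrorEar` the ear is 2 + k and its hub 3 + k: the first shape
-- under t ↦ 3 - t.
data Pattern (G : Graph n) : Set where
  ear : ∀ k → 3 + k < n →
    (∀ {y} → Joined G (1 + k) y → k ≤ y × y ≤ 2 + k) →
    (∀ {y} → Joined G (2 + k) y → k ≤ y × y ≤ 3 + k) → Pattern G
  mirrorEar : ∀ k → 3 + k < n →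
    (∀ {y} → Joined G (2 + k) y → 1 + k ≤ y × y ≤ 3 + k) →
    (∀ {y} → Joined G (1 + k) y → k ≤ y × y ≤ 3 + k) → Pattern G
  twoEars : ∀ k → 4 + k < n →
    (∀ {y} → Joined G (1 + k) y → k ≤ y × y ≤ 2 + k) →
    (∀ {y} → Joined G (2 + k) y → k ≤ y × y ≤ 4 + k) →
    (∀ {y} → Joined G (3 + k) y → 2 + k ≤ y × y ≤ 4 + k) → Pattern G

module Search {n} (G : Graph n) (nc : NonCrossing G) where
  private
    R : ℕ → ℕ → Set
    R = Joined G

    R? : ∀ x y → Dec (R x y)
    R? x y = any? λ i → any? λ j → (toℕ i ℕ.≟ x) ×-dec (toℕ j ℕ.≟ y) ×-dec (adj G i j Data.Bool.≟ true)

    R-sym : ∀ {x y} → R x y → R y x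
    R-sym (i , j , i≡ , j≡ , e) = j , i , j≡ , i≡ , adj-sym-true G e

    R-nc : ∀ {u x v y} → u < x → x < v → v < y → R u v → R x y → ⊥
    R-nc u<x x<v v<y (_ , _ , refl , refl , e) (_ , _ , refl , refl , f) = nc u<x x<v v<y e f

    Closed : ℕ → ℕ → Set
    Closed p q = ∀ {x y} → p < x → x < q → R x y → p ≤ y × y ≤ q

    Long : ℕ → ℕ → Set
    Long x y = 3 + x ≤ y ⊎ 3 + y ≤ x

    long? : ∀ p q → Dec (∃ λ i → ∃ λ j → adj G i j ≡ true × p < toℕ i × toℕ i < q × Long (toℕ i) (toℕ j))
    long? p q = any? λ i → any? λ j → (adj G i j Data.Bool.≟ true) ×-dec (p <? toℕ i) ×-dec (toℕ i <? q)
      ×-dec ((3 + toℕ i ≤? toℕ j) ⊎-dec (3 + toℕ j ≤? toℕ i))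

    chord-closed : ∀ {x y} → R x y → Closed x y
    chord-closed {x} {y} xy {z} {w} x<z z<y zw =
      ≮⇒≥ (λ w<x → R-nc w<x x<z z<y (R-sym zw) xy) , ≮⇒≥ (λ y<w → R-nc x<z z<y y<w xy zw)

    below : ∀ {y k} → y ≤ suc k → y ≢ suc k → y ≤ k
    below y≤ y≢ = ≤-pred (≤∧≢⇒< y≤ y≢)

    above : ∀ {y k} → k ≤ y → y ≢ k → suc k ≤ y
    above k≤ y≢ = ≤∧≢⇒< k≤ (≢-sym y≢)

    -- Edges at interior vertices span at most two, so the shape depends only on which short chords
    -- are present, and overlapping ones exclude each other. A chord from 1 + p to 3 + p makes 2 + p
    -- an ear and shifts the frame by one; if q = 3 + p there is no room for the shift and the
    -- mirror image is used.
    minimal : ∀ p q → 3 + p ≤ q → q < n → Closed p q →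
      (∀ {x y} → p < x → x < q → R x y → ¬ Long x y) → Pattern G
    minimal p q 3≤ q<n closed ¬long with R? (1 + p) (3 + p)
    ... | no ¬13 = case
      where
      N₁ : ∀ {y} → R (1 + p) y → p ≤ y × y ≤ 2 + p
      N₁ r = proj₁ (closed ≤-refl (≤-trans (n≤1+n _) 3≤) r) ,
        below (≮⇒≥ λ y> → ¬long ≤-refl (≤-trans (n≤1+n _) 3≤) r (inj₁ y>)) λ { refl → ¬13 r }
      N₂ : ∀ {y} → R (2 + p) y → p ≤ y × y ≤ 4 + p
      N₂ r = proj₁ (closed (m≤n+m _ 1) 3≤ r) , ≮⇒≥ λ y> → ¬long (m≤n+m _ 1) 3≤ r (inj₁ y>)
      case : Pattern G
      case with R? (2 + p) (4 + p)
      ... | no ¬24 = ear p (≤-<-trans 3≤ q<n) N₁ λ r → proj₁ (N₂ r) , below (proj₂ (N₂ r)) λ { refl → ¬24 r }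
      ... | yes 24r = twoEars p (≤-<-trans 4≤ q<n) N₁ N₂ λ r →
          above (≤-pred (≤-pred (≮⇒≥ λ y< → ¬long (m≤n+m _ 2) 4≤ r (inj₂ y<)))) (λ { refl → ¬13 (R-sym r) }) ,
          below (≮⇒≥ λ y> → ¬long (m≤n+m _ 2) 4≤ r (inj₁ y>)) λ { refl → R-nc ≤-refl ≤-refl ≤-refl 24r r }
        where
        4≤ : 4 + p ≤ q
        4≤ = proj₂ (closed (m≤n+m _ 1) 3≤ 24r)
    ... | yes 13r with m≤n⇒m<n∨m≡n 3≤
    ... | inj₂ refl = mirrorEar p q<n
      (λ r → let p≤y , y≤ = closed (m≤n+m _ 1) 3≤ r in
             above p≤y (λ { refl → R-nc ≤-refl ≤-refl ≤-refl (R-sym r) 13r }) , y≤)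
      (closed ≤-refl (m≤n+m _ 1))
    ... | inj₁ 4≤ = case
      where
      ¬24 : ¬ R (2 + p) (4 + p)
      ¬24 = R-nc ≤-refl ≤-refl ≤-refl 13r
      N₂ : ∀ {y} → R (2 + p) y → 1 + p ≤ y × y ≤ 3 + p
      N₂ r = above (proj₁ (closed (m≤n+m _ 1) 3≤ r)) (λ { refl → R-nc ≤-refl ≤-refl ≤-refl (R-sym r) 13r }) ,
        below (≮⇒≥ λ y> → ¬long (m≤n+m _ 1) 3≤ r (inj₁ y>)) λ { refl → ¬24 r }
      N₃ : ∀ {y} → R (3 + p) y → 1 + p ≤ y × y ≤ 5 + p
      N₃ r = ≤-pred (≤-pred (≮⇒≥ λ y< → ¬long (m≤n+m _ 2) 4≤ r (inj₂ y<))) ,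
        ≮⇒≥ λ y> → ¬long (m≤n+m _ 2) 4≤ r (inj₁ y>)
      case : Pattern G
      case with R? (3 + p) (5 + p)
      ... | no ¬35 = ear (1 + p) (≤-<-trans 4≤ q<n) N₂ λ r → proj₁ (N₃ r) , below (proj₂ (N₃ r)) λ { refl → ¬35 r }
      ... | yes 35r = twoEars (1 + p) (≤-<-trans 5≤ q<n) N₂ N₃ λ r →
          above (≤-pred (≤-pred (≮⇒≥ λ y< → ¬long (m≤n+m _ 3) 5≤ r (inj₂ y<)))) (λ { refl → ¬24 (R-sym r) }) ,
          below (≮⇒≥ λ y> → ¬long (m≤n+m _ 3) 5≤ r (inj₁ y>)) λ { refl → R-nc ≤-refl ≤-refl ≤-refl 35r r }
        where
        5≤ : 5 + p ≤ q
        5≤ = proj₂ (closed (m≤n+m _ 2) 4≤ 35r)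

    -- A long edge at an interior vertex stays within the closed interval and spans a strictly
    -- shorter one, which is closed by non-crossing. The fuel bounds the length.
    search : ∀ fuel p q → q ≤ fuel + p → 3 + p ≤ q → q < n → Closed p q → Pattern G
    search zero p q q≤p 3≤ q<n closed = ⊥-elim (m+1+n≰m p (subst (_≤ p) (+-comm 3 p) (≤-trans 3≤ q≤p)))
    search (suc fuel) p q q≤ 3≤ q<n closed with long? p q
    ... | no ¬∃ = minimal p q 3≤ q<n closed
      λ { p<x x<q (i , j , refl , refl , e) l → ¬∃ (i , j , e , p<x , x<q , l) }
    ... | yes (i , j , e , p<i , i<q , inj₁ l) =
      let r = i , j , refl , refl , e in
      search fuel (toℕ i) (toℕ j)
        (≤-trans (proj₂ (closed p<i i<q r)) (≤-trans q≤ (≤-trans (≤-reflexive (sym (+-suc fuel p))) (+-monoʳ-≤ fuel p<i))))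
        l (toℕ<n j) (chord-closed r)
    ... | yes (i , j , e , p<i , i<q , inj₂ l) =
      let r = i , j , refl , refl , e in
      search fuel (toℕ j) (toℕ i)
        (≤-trans (≤-pred (≤-trans i<q q≤)) (+-monoʳ-≤ fuel (proj₁ (closed p<i i<q r))))
        l (toℕ<n i) (chord-closed (R-sym r))

  pattern-exists : 3 < n → Pattern G
  pattern-exists 3<n = find n refl 3<n
    where
    find : ∀ n′ → n ≡ n′ → 3 < n′ → Pattern G
    -- The whole range is closed because no position lies outside it; its ends need not be adjacent.
    find (suc n′) refl 3<n = search n′ 0 n′ (m≤m+n n′ 0) (≤-pred 3<n) ≤-refl
      λ { _ _ (_ , j , _ , refl , _) → z≤n , toℕ≤pred[n] j }

-- Dihedral symmetries of the circle

delete-NC : ∀ (v : Fin (suc n)) {G} → NonCrossing G → NonCrossing (delete v G)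
delete-NC v nc u<x x<v v<y = nc (mono u<x) (mono x<v) (mono v<y)
  where
  mono : ∀ {i j} → i Fin.< j → punchIn v i Fin.< punchIn v j
  mono {i} {j} i<j = ≰⇒> λ p → <⇒≱ i<j (punchIn-cancel-≤ v j i p)

Dihedral : Permutation′ n → Set
Dihedral π = ∀ {G} → NonCrossing G → NonCrossing (relabel π G)

∘-dihedral : ∀ (π ρ : Permutation′ n) → Dihedral π → Dihedral ρ → Dihedral (π ∘ₚ ρ)
∘-dihedral π ρ dπ dρ {G} nc = dπ {relabel ρ G} (dρ {G} nc)

rotate : Permutation′ (suc n)
rotate {n} = insert (fromℕ n) fz idₚ

toℕ-punchIn-fromℕ : ∀ (j : Fin n) → toℕ (punchIn (fromℕ n) j) ≡ toℕ j
toℕ-punchIn-fromℕ fz     = refl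
toℕ-punchIn-fromℕ (fs j) = cong suc (toℕ-punchIn-fromℕ j)

rotate-spec : ∀ (i : Fin (suc n)) → rotate ⟨$⟩ʳ i ≡ fz × i ≡ fromℕ n ⊎ toℕ (rotate ⟨$⟩ʳ i) ≡ suc (toℕ i)
rotate-spec {n} i with fromℕ n ≟ i
... | yes eq = inj₁ (refl , sym eq)
... | no ne  = inj₂ (cong suc (trans (sym (toℕ-punchIn-fromℕ (punchOut ne))) (cong toℕ (punchIn-punchOut ne))))

rotate-suc : ∀ {i j : Fin (suc n)} → i Fin.< j → toℕ (rotate ⟨$⟩ʳ i) ≡ suc (toℕ i)
rotate-suc {i = i} {j} i<j with rotate-spec i
... | inj₂ eq         = eq
... | inj₁ (_ , refl) = ⊥-elim (<⇒≱ i<j (≤fromℕ j))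

-- Only the largest position `y` can wrap round to 0. Then the images of `y`, `u`, `x`, `v` increase
-- in this order and the two chords exchange roles.
rotate-dihedral : Dihedral (rotate {n})
rotate-dihedral {n} {G} nc {u} {x} {v} {y} u<x x<v v<y uv xy with rotate-spec y
... | inj₂ eqy = nc (step u<x (rotate-suc x<v)) (step x<v (rotate-suc v<y)) (step v<y eqy) uv xy
  where
  step : ∀ {i j : Fin (suc n)} → i Fin.< j → toℕ (rotate ⟨$⟩ʳ j) ≡ suc (toℕ j) →
    rotate ⟨$⟩ʳ i Fin.< rotate ⟨$⟩ʳ j
  step i<j eqj = subst₂ _<_ (sym (rotate-suc i<j)) (sym eqj) (s≤s i<j)
... | inj₁ (eqy , _) = nc (subst₂ _<_ (sym (cong toℕ eqy)) (sym (rotate-suc u<x)) (s≤s z≤n))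
    (subst₂ _<_ (sym (rotate-suc u<x)) (sym (rotate-suc x<v)) (s≤s u<x))
    (subst₂ _<_ (sym (rotate-suc x<v)) (sym (rotate-suc v<y)) (s≤s x<v)) (adj-sym-true G xy) uv

reverse-dihedral : Dihedral (reverse {n})
reverse-dihedral {n} {G} nc {u} {x} {v} {y} u<x x<v v<y uv xy =
  nc (op v<y) (op x<v) (op u<x) (adj-sym-true G xy) (adj-sym-true G uv)
  where
  op : ∀ {i j : Fin n} → i Fin.< j → opposite j Fin.< opposite i
  op {i} {j} i<j = subst₂ _<_ (sym (opposite-prop j)) (sym (opposite-prop i)) (∸-monoʳ-< (s≤s i<j) (toℕ<n j))

-- A symmetry moving position c t to position t, for t ≤ T.
Frame : (ℕ → ℕ) → ℕ → Permutation′ n → Set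
Frame c T π = ∀ {j t} → t ≤ T → toℕ (π ⟨$⟩ʳ j) ≡ c t → toℕ j ≡ t

rotations : ℕ → Permutation′ (suc n)
rotations zero    = idₚ
rotations (suc k) = rotations k ∘ₚ rotate

rotations-dihedral : ∀ k → Dihedral (rotations {n} k)
rotations-dihedral zero    nc = nc
rotations-dihedral (suc k) {G} = ∘-dihedral (rotations k) rotate (λ {G} → rotations-dihedral k {G}) (λ {G} → rotate-dihedral {G = G}) {G}

rotations-frame : ∀ k {j t} → toℕ (rotations {n} k ⟨$⟩ʳ j) ≡ k + t → toℕ j ≡ t
rotations-frame zero eq = eq
rotations-frame (suc k) {j} eq with rotate-spec (rotations k ⟨$⟩ʳ j)
... | inj₂ eq′ = rotations-frame k (suc-injective (trans (sym eq′) eq))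
... | inj₁ (eq′ , _) with () ← trans (sym (cong toℕ eq′)) eq

-- Rotation by n - K followed by a ↦ n - a is t ↦ K - t on the circle.
reflections : ℕ → Permutation′ (suc n)
reflections {n} K = rotations (n ∸ K) ∘ₚ reverse

reflections-dihedral : ∀ K → Dihedral (reflections {n} K)
reflections-dihedral {n} K {G} = ∘-dihedral (rotations (n ∸ K)) reverse (λ {G} → rotations-dihedral (n ∸ K) {G}) (λ {G} → reverse-dihedral {G = G}) {G}

reflections-frame : ∀ {K} → K ≤ n → Frame (K ∸_) K (reflections {n} K)
reflections-frame {n} {K} K≤n {j} {t} t≤K eq = rotations-frame (n ∸ K) (begin
  a                    ≡⟨ m∸[m∸n]≡n (toℕ≤pred[n] (rotations (n ∸ K) ⟨$⟩ʳ j)) ⟨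
  n ∸ (n ∸ a)          ≡⟨ cong (n ∸_) (trans (sym (opposite-prop (rotations (n ∸ K) ⟨$⟩ʳ j))) eq) ⟩
  n ∸ (K ∸ t)          ≡⟨ cong (_∸ (K ∸ t)) (m∸n+n≡m K≤n) ⟨
  (n ∸ K + K) ∸ (K ∸ t) ≡⟨ +-∸-assoc (n ∸ K) (m∸n≤m K t) ⟩
  n ∸ K + (K ∸ (K ∸ t)) ≡⟨ cong (n ∸ K +_) (m∸[m∸n]≡n t≤K) ⟩
  n ∸ K + t ∎)
  where
  open ≡-Reasoning
  a = toℕ (rotations (n ∸ K) ⟨$⟩ʳ j)

-- A frame tells where a position comes from; since `π` is onto, this also tells where it goes.
frame-at : ∀ {c T} {π : Permutation′ n} → Frame c T π → ∀ {t} → t ≤ T → c t < n →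
  ∀ {i} → toℕ i ≡ t → toℕ (π ⟨$⟩ʳ i) ≡ c t
frame-at {c = c} {π = π} fr {t} t≤T ct<n {i} i≡t = trans (cong (toℕ ∘ (π ⟨$⟩ʳ_)) i≡j) π-j
  where
  j = π ⟨$⟩ˡ fromℕ< ct<n
  π-j : toℕ (π ⟨$⟩ʳ j) ≡ c t
  π-j = trans (cong toℕ (inverseʳ π)) (toℕ-fromℕ< ct<n)
  i≡j : i ≡ j
  i≡j = toℕ-injective (trans i≡t (sym (fr t≤T π-j)))

module _ {G : Graph n} {c T} {π : Permutation′ n} (fr : Frame c T π) where
  frame-absent : ∀ {s} → s ≤ T → c s < n → (Q : ℕ → Set) →
    (∀ {y} → Joined G (c s) y → ∃ λ t → t ≤ T × Q t × y ≡ c t) →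
    ∀ i j → toℕ i ≡ s → ¬ Q (toℕ j) → adj (relabel π G) i j ≡ false
  frame-absent {s} s≤T cs<n Q nbrs i j i≡s ¬Qj = ¬-not λ e →
    let t , t≤T , Qt , eq = nbrs (π ⟨$⟩ʳ i , π ⟨$⟩ʳ j , frame-at {π = π} fr s≤T cs<n i≡s , refl , e)
    in ¬Qj (subst Q (sym (fr t≤T eq)) Qt)

frame-ear : ∀ {G : Graph (4 + m)} {c T} {π : Permutation′ (4 + m)} → Frame c T π → 3 ≤ T → c 1 < 4 + m → c 2 < 4 + m →
  (∀ {y} → Joined G (c 1) y → ∃ λ t → t ≤ T × t ≤ 2 × y ≡ c t) →
  (∀ {y} → Joined G (c 2) y → ∃ λ t → t ≤ T × t ≤ 3 × y ≡ c t) → Ear (relabel π G)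
frame-ear {G = G} {π = π} fr 3≤T c₁ c₂ N₁ N₂ = record
  { ear₁ = λ k → frame-absent {G = G} {π = π} fr (≤-trans (s≤s z≤n) 3≤T) c₁ (_≤ 2) N₁ 1F (fs (fs (fs k))) refl λ { (s≤s (s≤s ())) }
  ; ear₂ = λ k → frame-absent {G = G} {π = π} fr (≤-trans (s≤s (s≤s z≤n)) 3≤T) c₂ (_≤ 3) N₂ 2F (fs (fs (fs (fs k)))) refl λ { (s≤s (s≤s (s≤s ()))) }
  }

-- Two ears occur only from six vertices on, so that deleting both leaves the at least four vertices
-- for which the induction is stated.
data Position : ∀ m → Graph (4 + m) → Set where
  ear     : ∀ {G : Graph (4 + m)} π → NonCrossing (relabel π G) → Ear (relabel π G) → Position m G
  twoEars : ∀ {G : Graph (6 + m)} π → NonCrossing (relabel π G) → TwoEars (relabel π G) → Position (2 + m) G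

offset : ∀ {k y a b} → a + k ≤ y → y ≤ b + k → ∃ λ t → t ≤ b × a ≤ t × y ≡ k + t
offset {k} {y} {a} {b} a≤ ≤b = y ∸ k , m≤n+o⇒m∸n≤o y k (subst (y ≤_) (+-comm b k) ≤b) ,
  subst (_≤ y ∸ k) (m+n∸n≡m a k) (∸-monoˡ-≤ k a≤) , sym (m+[n∸m]≡n (≤-trans (m≤n+m k a) a≤))

position : ∀ m (G : Graph (4 + m)) → NonCrossing G → Position m G
position m G nc with Search.pattern-exists G nc (s≤s (s≤s (s≤s (s≤s z≤n))))
... | ear k 3+k< N₁ N₂ = ear π (rotations-dihedral k {G} nc)
    (frame-ear {G = G} {π = π} (λ {j} → λ (_ : _ ≤ 3) → rotations-frame k {j}) ≤-refl
      (subst (_< 4 + m) (+-comm 1 k) (≤-trans (s≤s (m≤n+m (1 + k) 2)) 3+k<))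
      (subst (_< 4 + m) (+-comm 2 k) (≤-trans (s≤s (m≤n+m (2 + k) 1)) 3+k<))
      (λ {y} r → let k≤ , ≤k = N₁ (subst (λ x → Joined G x y) (+-comm k 1) r)
                     t , t≤ , _ , eq = offset {a = 0} k≤ ≤k in t , ≤-trans t≤ (n≤1+n 2) , t≤ , eq)
      (λ {y} r → let k≤ , ≤k = N₂ (subst (λ x → Joined G x y) (+-comm k 2) r)
                     t , t≤ , _ , eq = offset {a = 0} k≤ ≤k in t , t≤ , t≤ , eq))
  where π = rotations k
... | mirrorEar k 3+k< N₂ N₁ = ear π (reflections-dihedral (3 + k) {G} nc)
    (frame-ear {G = G} {π = π} (reflections-frame (≤-pred 3+k<)) (m≤m+n 3 k)
      (≤-trans (s≤s (m≤n+m (2 + k) 1)) 3+k<)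
      (≤-trans (s≤s (m≤n+m (1 + k) 2)) 3+k<)
      (λ {y} r → let k≤ , ≤k = N₂ r in 3 + k ∸ y , m∸n≤m (3 + k) y ,
          m≤n+o⇒m∸n≤o (3 + k) y (subst (3 + k ≤_) (+-comm 2 y) (s≤s (s≤s k≤))) , sym (m∸[m∸n]≡n ≤k))
      (λ {y} r → let k≤ , ≤k = N₁ r in 3 + k ∸ y , m∸n≤m (3 + k) y ,
          m≤n+o⇒m∸n≤o (3 + k) y (subst (3 + k ≤_) (+-comm 3 y) (s≤s (s≤s (s≤s k≤)))) , sym (m∸[m∸n]≡n ≤k)))
  where π = reflections (3 + k)
position m G nc | twoEars k 4+k< N₁ N₂ N₃ = go m G nc k 4+k< N₁ N₂ N₃
  where
  go : ∀ m (G : Graph (4 + m)) → NonCrossing G → ∀ k → 4 + k < 4 + m →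
    (∀ {y} → Joined G (1 + k) y → k ≤ y × y ≤ 2 + k) →
    (∀ {y} → Joined G (2 + k) y → k ≤ y × y ≤ 4 + k) →
    (∀ {y} → Joined G (3 + k) y → 2 + k ≤ y × y ≤ 4 + k) → Position m G
  go zero G nc k 4+k< N₁ N₂ N₃ = ⊥-elim (m+n≮m 4 k 4+k<)
  -- In a pentagon the middle vertex 2 is a hub whose ear is 3.
  go (suc zero) G nc zero 4+k< N₁ N₂ N₃ = ear π (rotations-dihedral 2 {G} nc) (record
      { ear₁ = λ { 0F → ¬-not λ e → absurd₁ (N₃ (3F , 0F , refl , refl , e))
                 ; 1F → ¬-not λ e → absurd₂ (N₃ (3F , 1F , refl , refl , e)) }
      ; ear₂ = λ { 0F → ¬-not λ e → absurd₃ (N₁ (1F , 4F , refl , refl , adj-sym-true G e)) } })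
    where
    π = rotations 2
    absurd₁ : ¬ (2 ≤ 0 × 0 ≤ 4)
    absurd₁ (() , _)
    absurd₂ : ¬ (2 ≤ 1 × 1 ≤ 4)
    absurd₂ (s≤s () , _)
    absurd₃ : ¬ (0 ≤ 4 × 4 ≤ 2)
    absurd₃ (_ , s≤s (s≤s ()))
  go (suc zero) G nc (suc k) (s≤s (s≤s (s≤s (s≤s (s≤s ()))))) N₁ N₂ N₃
  go (suc (suc m)) G nc k 4+k< N₁ N₂ N₃ = twoEars π (rotations-dihedral k {G} nc) (record
      { ear₁ = λ j → absent (s≤s z≤n) (_≤ 2) (λ r → let k≤ , ≤k = N₁ r ; t , t≤ , _ , eq = offset {a = 0} k≤ ≤k in t , ≤-trans t≤ (m≤n+m 2 2) , t≤ , eq)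
                 1F (fs (fs (fs j))) refl λ { (s≤s (s≤s ())) }
      ; ear₂ = λ j → absent (s≤s (s≤s z≤n)) (_≤ 4) (λ r → let k≤ , ≤k = N₂ r ; t , t≤ , _ , eq = offset {a = 0} k≤ ≤k in t , t≤ , t≤ , eq)
                 2F (fs (fs (fs (fs (fs j))))) refl λ { (s≤s (s≤s (s≤s (s≤s ())))) }
      ; ear₃ = λ j → absent (s≤s (s≤s (s≤s z≤n))) (_≤ 4) (λ r → let k≤ , ≤k = N₃ r ; t , t≤ , _ , eq = offset {a = 2} k≤ ≤k in t , t≤ , t≤ , eq)
                 3F (fs (fs (fs (fs (fs j))))) refl λ { (s≤s (s≤s (s≤s (s≤s ())))) }
      ; ear₀ = absent (s≤s (s≤s (s≤s z≤n))) (2 ≤_) (λ r → let k≤ , ≤k = N₃ r ; t , t≤ , 2≤t , eq = offset {a = 2} k≤ ≤k in t , t≤ , 2≤t , eq)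
                 3F 0F refl λ ()
      })
    where
    π = rotations k
    absent : ∀ {s} → s ≤ 4 → (Q : ℕ → Set) →
      (∀ {y} → Joined G (s + k) y → ∃ λ t → t ≤ 4 × Q t × y ≡ k + t) →
      ∀ i j → toℕ i ≡ s → ¬ Q (toℕ j) → adj (relabel π G) i j ≡ false
    absent {s} s≤4 Q nbrs = frame-absent {G = G} {c = k +_} {T = 4} {π = π} (λ {j} → λ (_ : _ ≤ 4) → rotations-frame k {j}) s≤4
      (subst (_< 6 + m) (+-comm s k) (≤-trans (s≤s (+-monoˡ-≤ k s≤4)) 4+k<)) Q
      (λ {y} r → nbrs (subst (λ x → Joined G x y) (+-comm k s) r))

-- Subgraphs of the fan

nbrℕ⇒ : ∀ {a b} → nbrℕ a b ≡ true → suc a ≡ b ⊎ suc b ≡ a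
nbrℕ⇒ {a} {b} e with suc a ≡ᵇ b in p
... | true  = inj₁ (≡ᵇ⇒≡ (suc a) b (Equivalence.from T-≡ p))
... | false = inj₂ (≡ᵇ⇒≡ (suc b) a (Equivalence.from T-≡ e))

nbrℕ-suc : ∀ a → nbrℕ a (suc a) ≡ true
nbrℕ-suc a rewrite dec-true (suc a ℕ.≟ suc a) refl = refl

-- The second chord avoids the hub, so it is a rim edge and leaves no room for `v` between its ends.
Fan-NC : ∀ n → NonCrossing (Fan n)
Fan-NC n {x = fs x} {fs v} {fs y} _ (s≤s x<v) (s≤s v<y) _ xy with nbrℕ⇒ {toℕ x} {toℕ y} xy
... | inj₁ eq = <⇒≱ x<v (≤-pred (subst (toℕ v <_) (sym eq) v<y))
... | inj₂ eq = <⇒≱ (<-trans x<v v<y) (subst (toℕ y ≤_) eq (n≤1+n _))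

-- A chord from a ≥ 2 to some b > a + 1 crosses the spoke from 0 to a + 1, which a full hub
-- provides. Chords from 1 are excluded by the ear.
ear⇒⊆Fan : {G : Graph (4 + m)} → NonCrossing G → Ear G → (∀ k → adj G 0F (fs (fs (fs k))) ≡ true) → G ⊆ Fan (4 + m)
ear⇒⊆Fan {m} {G} nc e hub = sub
  where
  open Ear e
  hub′ : ∀ l → 2 ≤ toℕ l → adj G 0F (fs l) ≡ true
  hub′ (fs (fs k)) _ = hub k
  hub′ 1F (s≤s ())
  consecutive : ∀ i j → i Fin.< j → adj G (fs i) (fs j) ≡ true → nbrℕ (toℕ i) (toℕ j) ≡ true
  consecutive i j i<j ij with m≤n⇒m<n∨m≡n i<j
  ... | inj₂ eq = subst (λ b → nbrℕ (toℕ i) b ≡ true) eq (nbrℕ-suc (toℕ i))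
  consecutive 0F 1F i<j ij | inj₁ (s≤s ())
  consecutive 0F (fs (fs k)) i<j ij | inj₁ i+1<j = ⊥-elim (false⇒¬true (ear₁ k) ij)
  consecutive (fs i) j i<j ij | inj₁ i+1<j = ⊥-elim
    (nc (s≤s z≤n) (s≤s (subst (toℕ (fs i) <_) (sym l≡) ≤-refl)) (s≤s (subst (_< toℕ j) (sym l≡) i+1<j))
      (hub′ l (subst (2 ≤_) (sym l≡) (s≤s (s≤s z≤n)))) ij)
    where
    l< = <-trans i+1<j (toℕ<n j)
    l = fromℕ< l<
    l≡ : toℕ l ≡ 2 + toℕ i
    l≡ = toℕ-fromℕ< l<
  sub : G ⊆ Fan (4 + m)
  sub 0F     0F     e = ⊥-elim (adj⇒≢ G e refl)
  sub 0F     (fs j) e = refl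
  sub (fs i) 0F     e = refl
  sub (fs i) (fs j) e with Finₚ.<-cmp i j
  ... | tri< i<j _ _  = consecutive i j i<j e
  ... | tri≈ _ refl _ = ⊥-elim (adj⇒≢ G e refl)
  ... | tri> _ _ j<i  = trans (nbrℕ-sym (toℕ i) (toℕ j)) (consecutive j i j<i (adj-sym-true G e))

-- The path `w 0 i j` contains the spoke to `i` and the rim edge `i j`, so this family covers all
-- edges of the fan.
fan-path : ∀ (i j : Fin (3 + m)) → nbrℕ (toℕ i) (toℕ j) ≡ true → ∃ λ w → IsPath (Fan (4 + m)) (fs w) 0F (fs i) (fs j)
fan-path {m} i j ij = let w , w≢i , w≢j = third i j in
  w , isPath refl refl ij (w≢i ∘ Finₚ.suc-injective) (w≢j ∘ Finₚ.suc-injective) (λ ())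
  where
  third : ∀ (i j : Fin (3 + m)) → ∃ λ w → w ≢ i × w ≢ j
  third 0F          0F          = 1F , (λ ()) , λ ()
  third 0F          1F          = 2F , (λ ()) , λ ()
  third 0F          (fs (fs j)) = 1F , (λ ()) , λ ()
  third 1F          0F          = 2F , (λ ()) , λ ()
  third (fs (fs i)) 0F          = 1F , (λ ()) , λ ()
  third (fs i)      (fs j)      = 0F , (λ ()) , λ ()

path-neighbour : ∀ (i : Fin (2 + m)) → ∃ λ (j : Fin (2 + m)) → nbrℕ (toℕ i) (toℕ j) ≡ true
path-neighbour 0F = 1F , refl
path-neighbour 1F = 0F , refl
path-neighbour {suc m} (fs (fs i)) = let j , e = path-neighbour (fs i) in fs j , e

tight⇒Fan : {G : Graph (4 + m)} → G ⊆ Fan (4 + m) → E G ≡ E (Fan (4 + m)) → ∀ x y → adj G x y ≡ fanAdj x y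
tight⇒Fan {m} {G} G⊆F eq x y with adj G x y in e
... | true  = sym (G⊆F x y e)
... | false = sym (¬-not λ f → false⇒¬true e (F⊆G x y f))
  where
  tight : ∀ {w x y z} → IsPath (Fan (4 + m)) w x y z → IsPath G w x y z
  tight = E-tight {G = G} {Fan (4 + m)} G⊆F eq
  F⊆G : Fan (4 + m) ⊆ G
  F⊆G 0F     (fs i) _  = let j , ij = path-neighbour i ; _ , p = fan-path i j ij in xy (tight p)
  F⊆G (fs i) 0F     _  = let j , ij = path-neighbour i ; _ , p = fan-path i j ij in adj-sym-true G (xy (tight p))
  F⊆G (fs i) (fs j) ij = let _ , p = fan-path i j ij in yz (tight p)

-- The induction

-- In terms of the number n of vertices of `G`, the losses are 4n - 10 for `drop₁` and 7n - 15 for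
-- `drop₂`.
data Step : ∀ m → Graph (4 + m) → Set where
  inFan : ∀ {G : Graph (4 + m)} π → relabel π G ⊆ Fan (4 + m) → Step m G
  drop₁ : ∀ {G : Graph (4 + m)} (H : Graph (3 + m)) → NonCrossing H → E G ≤ E H + 2 * (6 + 4 * m) → Step m G
  drop₂ : ∀ {G : Graph (6 + m)} (H : Graph (4 + m)) → NonCrossing H → E G ≤ E H + 2 * (27 + 7 * m) → Step (2 + m) G

-- Deleting ear 1 leaves 3 as an ear whose hub is 4, seen through the reflection t ↦ 3 − t.
dropTwoEars : (G : Graph (5 + m)) → NonCrossing G → TwoEars G →
  Σ (Graph (3 + m)) λ H → NonCrossing H × E G ≤ E H + 2 * (20 + 7 * m)
dropTwoEars {m} G nc e = delete 1F B , delete-NC 1F {B} ncB , bound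
  where
  open TwoEars e
  -- The vertices 2, 3, 4 of `G` are renumbered 1, 2, 3 in `D`.
  D = delete 1F G
  π = reflections {3 + m} 3
  B = relabel π D
  ncB : NonCrossing B
  ncB = reflections-dihedral 3 {D} (delete-NC 1F {G} nc)
  fr : Frame (3 ∸_) 3 π
  fr = reflections-frame {3 + m} {3} (m≤m+n 3 m)
  at : ∀ {t} → t ≤ 3 → 3 ∸ t < 4 + m → ∀ {i i′} → toℕ i ≡ t → toℕ i′ ≡ 3 ∸ t → π ⟨$⟩ʳ i ≡ i′
  at t≤ lt i≡ i′≡ = toℕ-injective (trans (frame-at {π = π} fr t≤ lt i≡) (sym i′≡))
  π₀ : π ⟨$⟩ʳ 0F ≡ 3F
  π₀ = at z≤n (m≤m+n 4 m) refl refl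
  π₁ : π ⟨$⟩ʳ 1F ≡ 2F
  π₁ = at (s≤s z≤n) (s≤s (s≤s (s≤s z≤n))) refl refl
  π₂ : π ⟨$⟩ʳ 2F ≡ 1F
  π₂ = at (s≤s (s≤s z≤n)) (s≤s (s≤s z≤n)) refl refl
  π₃ : π ⟨$⟩ʳ 3F ≡ 0F
  π₃ = at ≤-refl (s≤s z≤n) refl refl
  N₁ : ∀ {y} → Joined D 2 y → ∃ λ t → t ≤ 3 × t ≤ 2 × y ≡ 3 ∸ t
  N₁ (2F , 0F , _ , refl , e) = ⊥-elim (false⇒¬true ear₀ e)
  N₁ (2F , 1F , _ , refl , e) = 2 , n≤1+n 2 , ≤-refl , refl
  N₁ (2F , 2F , _ , refl , e) = 1 , s≤s z≤n , s≤s z≤n , refl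
  N₁ (2F , 3F , _ , refl , e) = 0 , z≤n , z≤n , refl
  N₁ (2F , fs (fs (fs (fs k))) , _ , refl , e) = ⊥-elim (false⇒¬true (ear₃ k) e)
  N₂ : ∀ {y} → Joined D 1 y → ∃ λ t → t ≤ 3 × t ≤ 3 × y ≡ 3 ∸ t
  N₂ (1F , 0F , _ , refl , e) = 3 , ≤-refl , ≤-refl , refl
  N₂ (1F , 1F , _ , refl , e) = 2 , n≤1+n 2 , n≤1+n 2 , refl
  N₂ (1F , 2F , _ , refl , e) = 1 , s≤s z≤n , s≤s z≤n , refl
  N₂ (1F , 3F , _ , refl , e) = 0 , z≤n , z≤n , refl
  N₂ (1F , fs (fs (fs (fs k))) , _ , refl , e) = ⊥-elim (false⇒¬true (ear₂ k) e)
  earB : Ear B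
  earB = frame-ear {G = D} {π = π} fr ≤-refl (s≤s (s≤s (s≤s z≤n))) (s≤s (s≤s z≤n)) N₁ N₂
  -- Cancelling the three known values from the invariant total sum avoids describing `π` beyond
  -- position 3.
  moved : (h : Fin (4 + m) → ℕ) → (sum λ k → h (π ⟨$⟩ʳ fs (fs (fs k)))) ≡ h 0F + sum λ k → h (fs (fs (fs (fs k))))
  moved h = +-cancelˡ-≡ (h 3F + h 2F + h 1F) _ _ (begin
    h 3F + h 2F + h 1F + tailπ ≡⟨ cong₂ (λ a b → a + h 1F + b) (cong₂ (λ i j → h i + h j) π₀ π₁) refl ⟨
    h (π ⟨$⟩ʳ 0F) + h (π ⟨$⟩ʳ 1F) + h 1F + tailπ ≡⟨ cong (λ i → h (π ⟨$⟩ʳ 0F) + h (π ⟨$⟩ʳ 1F) + h i + tailπ) π₂ ⟨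
    h (π ⟨$⟩ʳ 0F) + h (π ⟨$⟩ʳ 1F) + h (π ⟨$⟩ʳ 2F) + tailπ ≡⟨ assoc₃ (h (π ⟨$⟩ʳ 0F)) _ _ _ ⟩
    h (π ⟨$⟩ʳ 0F) + (h (π ⟨$⟩ʳ 1F) + (h (π ⟨$⟩ʳ 2F) + tailπ)) ≡⟨ expand (λ i → h (π ⟨$⟩ʳ i)) ⟨
    (sum λ i → h (π ⟨$⟩ʳ i)) ≡⟨ sum-permute π ⟨
    sum h ≡⟨ expand h ⟩
    h 0F + (h 1F + (h 2F + (sum λ k → h (fs (fs (fs k)))))) ≡⟨ cong (λ s → h 0F + (h 1F + (h 2F + s))) (sum-suc _) ⟩
    h 0F + (h 1F + (h 2F + (h 3F + rest))) ≡⟨ arith (h 0F) (h 1F) (h 2F) (h 3F) rest ⟩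
    h 3F + h 2F + h 1F + (h 0F + rest) ∎)
    where
    open ≡-Reasoning
    tailπ rest : ℕ
    tailπ = sum λ k → h (π ⟨$⟩ʳ fs (fs (fs k)))
    rest  = sum λ k → h (fs (fs (fs (fs k))))
    expand : ∀ (f : Fin (4 + m) → ℕ) → sum f ≡ f 0F + (f 1F + (f 2F + (sum λ k → f (fs (fs (fs k))))))
    expand f = trans (sum-suc f) (cong (f 0F +_) (trans (sum-suc _) (cong (f 1F +_) (sum-suc _))))
    assoc₃ : ∀ a b c d → a + b + c + d ≡ a + (b + (c + d))
    assoc₃ = solve-∀
    arith : ∀ a b c d r → a + (b + (c + (d + r))) ≡ d + c + b + (a + r)
    arith = solve-∀
  hub≡ : hubDeg B ≡ cornerDeg₄ G
  hub≡ = trans (sum-cong λ k → cong (λ i → bit (adj D i (π ⟨$⟩ʳ fs (fs (fs k))))) π₀) (moved (λ z → bit (adj D 3F z)))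
  corner≡ : cornerDeg B ≡ hubDeg₄ G
  corner≡ = cong₂ _+_ (cong₂ (λ i j → bit (adj D i j)) π₃ π₀)
    (trans (sum-cong λ k → cong (λ i → bit (adj D i (π ⟨$⟩ʳ fs (fs (fs k))))) π₃)
    (trans (moved (λ z → bit (adj D 0F z))) (cong (λ b → bit b + sum λ k → bit (adj D 0F (fs (fs (fs (fs k)))))) (adj-irrefl D 0F))))
  bound : E G ≤ E (delete 1F B) + 2 * (20 + 7 * m)
  bound = begin
    E G ≤⟨ E-TwoEars≤ G nc e ⟩
    E D + 2 * (8 + 2 * m + 2 * h + c) ≡⟨ cong (_+ 2 * (8 + 2 * m + 2 * h + c)) (E-relabel π D) ⟨
    E B + 2 * (8 + 2 * m + 2 * h + c) ≤⟨ +-monoˡ-≤ _ (E-Ear≤ B ncB earB) ⟩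
    E (delete 1F B) + 2 * (3 + 2 * m + 2 * hubDeg B + cornerDeg B) + 2 * (8 + 2 * m + 2 * h + c)
      ≡⟨ cong₂ (λ a b → E (delete 1F B) + 2 * (3 + 2 * m + 2 * a + b) + 2 * (8 + 2 * m + 2 * h + c)) hub≡ corner≡ ⟩
    E (delete 1F B) + 2 * (3 + 2 * m + 2 * c + h) + 2 * (8 + 2 * m + 2 * h + c)
      ≡⟨ arith₁ (E (delete 1F B)) m h c ⟩
    E (delete 1F B) + 2 * (11 + 4 * m + 3 * (h + c))
      ≤⟨ +-monoʳ-≤ (E (delete 1F B)) (*-monoʳ-≤ 2 (+-monoʳ-≤ (11 + 4 * m) (*-monoʳ-≤ 3 (hub+corner₄≤ G nc e)))) ⟩
    E (delete 1F B) + 2 * (11 + 4 * m + 3 * (3 + m)) ≡⟨ arith₂ (E (delete 1F B)) m ⟩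
    E (delete 1F B) + 2 * (20 + 7 * m) ∎
    where
    open ≤-Reasoning
    h = hubDeg₄ G
    c = cornerDeg₄ G
    arith₁ : ∀ e m h c → e + 2 * (3 + 2 * m + 2 * c + h) + 2 * (8 + 2 * m + 2 * h + c) ≡ e + 2 * (11 + 4 * m + 3 * (h + c))
    arith₁ = solve-∀
    arith₂ : ∀ e m → e + 2 * (11 + 4 * m + 3 * (3 + m)) ≡ e + 2 * (20 + 7 * m)
    arith₂ = solve-∀

step : ∀ m (G : Graph (4 + m)) → NonCrossing G → Step m G
step m G nc with position m G nc
... | ear π ncB earB with sum-bit-full (λ k → adj (relabel π G) 0F (fs (fs (fs k))))
...   | inj₁ full = inFan π (ear⇒⊆Fan {G = relabel π G} ncB earB full)
-- A missed vertex gives `hubDeg` ≤ m; a full hub would have m + 1 and lose 7 + 4m.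
...   | inj₂ hub≤ = drop₁ (delete 1F B) (delete-NC 1F {B} ncB) (begin
    E G ≡⟨ E-relabel π G ⟨
    E B ≤⟨ E-Ear≤ B ncB earB ⟩
    E (delete 1F B) + 2 * (3 + 2 * m + 2 * hubDeg B + cornerDeg B)
      ≡⟨ cong (λ s → E (delete 1F B) + 2 * s) (arith₁ m (hubDeg B) (cornerDeg B)) ⟩
    E (delete 1F B) + 2 * (3 + 2 * m + (hubDeg B + (hubDeg B + cornerDeg B)))
      ≤⟨ +-monoʳ-≤ (E (delete 1F B)) (*-monoʳ-≤ 2 (+-monoʳ-≤ (3 + 2 * m) (+-mono-≤ hub≤ (hub+corner≤ B ncB earB)))) ⟩
    E (delete 1F B) + 2 * (3 + 2 * m + (m + (3 + m))) ≡⟨ cong (λ s → E (delete 1F B) + 2 * s) (arith₂ m) ⟩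
    E (delete 1F B) + 2 * (6 + 4 * m) ∎)
  where
  open ≤-Reasoning
  B = relabel π G
  arith₁ : ∀ m d c → 3 + 2 * m + 2 * d + c ≡ 3 + 2 * m + (d + (d + c))
  arith₁ = solve-∀
  arith₂ : ∀ m → 3 + 2 * m + (m + (3 + m)) ≡ 6 + 4 * m
  arith₂ = solve-∀
step (suc (suc m)) G nc | twoEars π ncB twoB =
  let H , ncH , le = dropTwoEars (relabel π G) ncB twoB in
  drop₂ H ncH (subst₂ _≤_ (E-relabel π G) (arith (E H) m) le)
  where
  arith : ∀ e m → e + 2 * (20 + 7 * suc m) ≡ e + 2 * (27 + 7 * m)
  arith = solve-∀

-- maxP₄ m bounds the copies of P₄ on 4 + m vertices; six vertices (m = 2) are the only
-- exception to 2n² − 7n + 2.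
maxP₄ : ℕ → ℕ
maxP₄ 0 = 6
maxP₄ 1 = 17
maxP₄ 2 = 33
maxP₄ (suc (suc (suc j))) = 51 + 21 * j + 2 * (j * j)

triangle : (G : Graph 3) → E G ≤ 0
triangle G = ≤-trans (E-mono {G = G} {Fan 3} sub) E-Fan3
  where
  opaque
    unfolding sum
    E-Fan3 : E (Fan 3) ≤ 0
    E-Fan3 = z≤n
  sub : G ⊆ Fan 3
  sub 0F     (fs j) e = refl
  sub (fs i) 0F     e = refl
  sub 1F     2F     e = refl
  sub 2F     1F     e = refl
  sub 0F     0F     e = ⊥-elim (adj⇒≢ G e refl)
  sub 1F     1F     e = ⊥-elim (adj⇒≢ G e refl)
  sub 2F     2F     e = ⊥-elim (adj⇒≢ G e refl)

inFan-E : ∀ (G : Graph (4 + m)) π → relabel π G ⊆ Fan (4 + m) → E G ≤ E (Fan (4 + m))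
inFan-E G π sub = ≤-trans (≤-reflexive (sym (E-relabel π G))) (E-mono {G = relabel π G} {Fan _} sub)

E-fan≡ : ∀ j → E (Fan (7 + j)) ≡ 2 * maxP₄ (3 + j)
E-fan≡ j = trans (E-fan (3 + j)) (arith j)
  where
  arith : ∀ j → 2 * (6 + 9 * (3 + j) + 2 * ((3 + j) * (3 + j))) ≡ 2 * (51 + 21 * j + 2 * (j * j))
  arith = solve-∀

Bounded : ℕ → Set
Bounded m = (G : Graph (4 + m)) → NonCrossing G → E G ≤ 2 * maxP₄ m

-- With n = 9 + k the hypotheses concern at least seven vertices, past the excess at six. The
-- margins, in copies, are 1 after one deletion and n - 7 after two.
fan-or-fewer : ∀ k → Bounded (4 + k) → Bounded (3 + k) → (G : Graph (9 + k)) → NonCrossing G →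
  (∃ λ π → relabel π G ⊆ Fan (9 + k)) ⊎ E G < 2 * maxP₄ (5 + k)
fan-or-fewer k ih₁ ih₂ G nc with step (5 + k) G nc
... | inFan π sub = inj₁ (π , sub)
... | drop₁ H ncH le = inj₂ (≤-trans (s≤s (≤-trans le (+-monoˡ-≤ _ (ih₁ H ncH)))) (≤-trans (n≤1+n _) (≤-reflexive (arith k))))
  where
  arith : ∀ k → 2 + (2 * (51 + 21 * (1 + k) + 2 * ((1 + k) * (1 + k))) + 2 * (6 + 4 * (5 + k)))
    ≡ 2 * (51 + 21 * (2 + k) + 2 * ((2 + k) * (2 + k)))
  arith = solve-∀
... | drop₂ H ncH le = inj₂ (≤-trans (s≤s (≤-trans le (+-monoˡ-≤ _ (ih₂ H ncH)))) (≤-trans (m≤m+n _ (3 + 2 * k)) (≤-reflexive (arith k))))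
  where
  arith : ∀ k → 1 + (2 * (51 + 21 * k + 2 * (k * k)) + 2 * (27 + 7 * (3 + k))) + (3 + 2 * k)
    ≡ 2 * (51 + 21 * (2 + k) + 2 * ((2 + k) * (2 + k)))
  arith = solve-∀

bounded₀ : Bounded 0
bounded₀ G nc with step 0 G nc
... | inFan π sub = ≤-trans (inFan-E G π sub) (≤-reflexive (E-fan 0))
... | drop₁ H _ le = ≤-trans le (+-monoˡ-≤ 12 (triangle H))

bounded₁ : Bounded 1
bounded₁ G nc with step 1 G nc
... | inFan π sub = ≤-trans (inFan-E G π sub) (≤-reflexive (E-fan 1))
... | drop₁ H ncH le = ≤-trans le (≤-trans (+-monoˡ-≤ 20 (bounded₀ H ncH)) (m≤n+m 32 2))

bounded₂ : Bounded 2
bounded₂ G nc with step 2 G nc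
... | inFan π sub = ≤-trans (inFan-E G π sub) (≤-trans (≤-reflexive (E-fan 2)) (m≤n+m 64 2))
... | drop₁ H ncH le = ≤-trans le (≤-trans (+-monoˡ-≤ 28 (bounded₁ H ncH)) (m≤n+m 62 4))
-- The source of the exceptional value: 6 + 27 = 33, against 32 for the fan.
... | drop₂ H ncH le = ≤-trans le (+-monoˡ-≤ 54 (bounded₀ H ncH))

bounded₃ : Bounded 3
bounded₃ G nc with step 3 G nc
... | inFan π sub = ≤-trans (inFan-E G π sub) (≤-reflexive (E-fan 3))
-- Here 33 + 18 = 51 is the fan value: the copy saved by a hub that is not full absorbs the excess.
... | drop₁ H ncH le = ≤-trans le (+-monoˡ-≤ 36 (bounded₂ H ncH))
... | drop₂ H ncH le = ≤-trans le (+-monoˡ-≤ 68 (bounded₁ H ncH))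

bounded₄ : Bounded 4
bounded₄ G nc with step 4 G nc
... | inFan π sub = ≤-trans (inFan-E G π sub) (≤-reflexive (E-fan 4))
... | drop₁ H ncH le = ≤-trans le (≤-trans (+-monoˡ-≤ 44 (bounded₃ H ncH)) (m≤n+m 146 2))
-- Since 33 + 41 = 74 equals the fan value, this estimate is not strict on eight vertices.
... | drop₂ H ncH le = ≤-trans le (+-monoˡ-≤ 82 (bounded₂ H ncH))

bounded-step : ∀ k → Bounded (4 + k) → Bounded (3 + k) → Bounded (5 + k)
bounded-step k ih₁ ih₂ G nc with fan-or-fewer k ih₁ ih₂ G nc
... | inj₁ (π , sub) = ≤-trans (inFan-E G π sub) (≤-reflexive (E-fan≡ (2 + k)))
... | inj₂ lt        = <⇒≤ lt

bounded : ∀ j → Bounded (3 + j)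
bounded zero          = bounded₃
bounded (suc zero)    = bounded₄
bounded (suc (suc k)) = bounded-step k (bounded (suc k)) (bounded k)

-- From outerplanar graphs to the closed formula

formula : ∀ k → 2 * (8 + k) * (8 + k) ∸ 7 * (8 + k) + 2 ≡ maxP₄ (4 + k)
formula k = trans (cong (λ a → a ∸ 7 * (8 + k) + 2) (arith₁ k))
  -- Splitting 7n off 2n² shows that the truncated subtraction is exact.
  (trans (cong (_+ 2) (m+n∸n≡m (72 + 25 * k + 2 * (k * k)) (7 * (8 + k)))) (arith₂ k))
  where
  arith₁ : ∀ k → 2 * (8 + k) * (8 + k) ≡ 72 + 25 * k + 2 * (k * k) + 7 * (8 + k)
  arith₁ = solve-∀
  arith₂ : ∀ k → 72 + 25 * k + 2 * (k * k) + 2 ≡ 51 + 21 * (1 + k) + 2 * ((1 + k) * (1 + k))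
  arith₂ = solve-∀

-- Relabelling by the inverse of `pos` makes every vertex its own position on the circle.
onCircle : (G : Graph n) → Outerplanar G → ∃ λ π → NonCrossing (relabel π G)
onCircle G (pos , planar) = flip pos , λ u<x x<v v<y uv xy →
  planar _ _ _ _ (Equivalence.from T-≡ uv) (Equivalence.from T-≡ xy) (place u<x , place x<v , place v<y)
  where
  place : ∀ {i j} → i Fin.< j → (pos ⟨$⟩ʳ (pos ⟨$⟩ˡ i)) Fin.< (pos ⟨$⟩ʳ (pos ⟨$⟩ˡ j))
  place i<j = subst₂ Fin._<_ (sym (inverseʳ pos)) (sym (inverseʳ pos)) i<j

Fan-outerplanar : ∀ n → Outerplanar (Fan n)
Fan-outerplanar n = idₚ , λ u v x y uv xy (u<x , x<v , v<y) →
  Fan-NC n {u} {x} {v} {y} u<x x<v v<y (Equivalence.to T-≡ uv) (Equivalence.to T-≡ xy)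

half : ∀ a → 2 * a / 2 ≡ a
half a = trans (cong (_/ 2) (*-comm 2 a)) (m*n/n≡m a 2)

outerplanar-E≤ : ∀ k (G : Graph (8 + k)) → Outerplanar G → E G ≤ 2 * maxP₄ (4 + k)
outerplanar-E≤ k G op = let π , nc = onCircle G op in
  subst (_≤ 2 * maxP₄ (4 + k)) (E-relabel π G) (bounded (1 + k) (relabel π G) nc)

extremal⇒Fan : ∀ k (G : Graph (9 + k)) → Outerplanar G → 2 * maxP₄ (5 + k) ≤ E G → G ≅ Fan (9 + k)
extremal⇒Fan k G op big with onCircle G op
... | ρ , nc with fan-or-fewer k (bounded (1 + k)) (bounded k) (relabel ρ G) nc
... | inj₂ lt = ⊥-elim (<⇒≱ lt (subst (2 * maxP₄ (5 + k) ≤_) (sym (E-relabel ρ G)) big))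
... | inj₁ (π , sub) = flip σ , λ x y →
    trans (cong₂ (adj G) (sym (inverseʳ σ)) (sym (inverseʳ σ))) (same (σ ⟨$⟩ˡ x) (σ ⟨$⟩ˡ y))
  where
  σ = π ∘ₚ ρ
  same : ∀ x y → adj G (σ ⟨$⟩ʳ x) (σ ⟨$⟩ʳ y) ≡ fanAdj x y
  same = tight⇒Fan {G = relabel σ G} sub (≤-antisym (E-mono {G = relabel σ G} {Fan _} sub)
    (subst₂ _≤_ (sym (E-fan≡ (2 + k))) (sym (E-relabel σ G)) big))

theorem3 : ((n : ℕ) → 8 ≤ n →
    ((G : Graph n) → Outerplanar G → copies (Path 4) G ≤ 2 * n * n ∸ 7 * n + 2)
    × Σ (Graph n) (λ G → Outerplanar G × copies (Path 4) G ≡ 2 * n * n ∸ 7 * n + 2))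
    × ((n : ℕ) → 9 ≤ n → (G : Graph n) → Outerplanar G →
    copies (Path 4) G ≡ 2 * n * n ∸ 7 * n + 2 → G ≅ Fan n)
theorem3 = extremal-number , uniqueness
  where
  extremal-number : (n : ℕ) → 8 ≤ n →
    ((G : Graph n) → Outerplanar G → copies (Path 4) G ≤ 2 * n * n ∸ 7 * n + 2)
    × Σ (Graph n) (λ G → Outerplanar G × copies (Path 4) G ≡ 2 * n * n ∸ 7 * n + 2)
  extremal-number _ (s≤s (s≤s (s≤s (s≤s (s≤s (s≤s (s≤s (s≤s (z≤n {k}))))))))) = upper , Fan (8 + k) , Fan-outerplanar (8 + k) , value
    where
    upper : (G : Graph (8 + k)) → Outerplanar G → copies (Path 4) G ≤ 2 * (8 + k) * (8 + k) ∸ 7 * (8 + k) + 2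
    upper G op = subst₂ _≤_ (sym (copies≡ G)) (trans (half (maxP₄ (4 + k))) (sym (formula k)))
      (/-monoˡ-≤ 2 (outerplanar-E≤ k G op))
    value : copies (Path 4) (Fan (8 + k)) ≡ 2 * (8 + k) * (8 + k) ∸ 7 * (8 + k) + 2
    value = trans (copies≡ (Fan (8 + k))) (trans (cong (_/ 2) (E-fan≡ (1 + k)))
      (trans (half (maxP₄ (4 + k))) (sym (formula k))))
  uniqueness : (n : ℕ) → 9 ≤ n → (G : Graph n) → Outerplanar G →
    copies (Path 4) G ≡ 2 * n * n ∸ 7 * n + 2 → G ≅ Fan n
  uniqueness _ (s≤s (s≤s (s≤s (s≤s (s≤s (s≤s (s≤s (s≤s (s≤s (z≤n {k})))))))))) G op eq = extremal⇒Fan k G op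
    -- Halving rounds down, so the number of copies yields a lower bound on `E G`; the matching
    -- upper bound comes from inclusion in the fan.
    (subst (_≤ E G) (trans (cong (_* 2) (trans (sym (copies≡ G)) (trans eq (formula (suc k))))) (*-comm (maxP₄ (5 + k)) 2))
      (m/n*n≤m (E G) 2))
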